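{- For every strictly positive non-atomic measure $\mu$ on the Cantor algebra $\mathfrak{A}_c$, the $\mu$-Jordan extension algebra $(\mathcal{J}_\mu,\widehat{\mu})$ is metrically isomorphic to the Jordan algebra with the Lebesgue measure, $(\mathcal{J},\widehat{\lambda})$.
   Context: A measure on a Boolean algebra is a finitely additive non-negative function with value $1$ at the unit; it is non-atomic if for every $\varepsilon>0$ there is a finite partition of unity into elements of measure at most $\varepsilon$. $\mathfrak{A}_c$ is the algebra of clopen subsets of $2^\omega$ and $\mathfrak{C}$ is the Cohen algebra, the completion of $\mathfrak{A}_c$. For a measure $\mu$ on $\mathfrak{A}_c$ and $a\in\mathfrak{C}$ let $\mu_*(a)=\sup\{\mu(b):b\in\mathfrak{A}_c,\ b\le a\}$ and $\mu^*(a)=\inf\{\mu(b):b\in\mathfrak{A}_c,\ a\le b\}$. Then $\mathcal{J}_\mu=\{a\in\mathfrak{C}:\mu_*(a)=\mu^*(a)\}$, and $\widehat{\mu}(a)=\mu_*(a)=\mu^*(a)$ for $a\in\mathcal{J}_\mu$ is the unique extension of $\mu$ to $\mathcal{J}_\mu$. $\lambda$ is the Lebesgue measure on $\mathfrak{A}_c$, $\lambda([s])=2^{ -n}$ for $s\in2^n$, where $[s]=\{x\in2^\omega:x\text{ extends }s\}$; the Jordan algebra is $\mathcal{J}=\mathcal{J}_\lambda$. A metric isomorphism is a measure-preserving Boolean isomorphism (only finitary operations need be preserved). -}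

module Defs where

open import Algebra.Lattice using (BooleanAlgebra)
import Algebra.Lattice.Properties.BooleanAlgebra as BooleanProperties
open import Algebra.Lattice.Morphism.Structures using (IsLatticeIsomorphism)
open import Algebra.Lattice.Structures.Biased
  using (isDistributiveLatticeʳʲᵐ; isBooleanAlgebraʳ)
open import Data.Bool.Base as Bool using (Bool; true; false; if_then_else_)
import Data.Bool.Properties as Bool
open import Data.List.Base using (List; foldr)
open import Data.List.Relation.Unary.All using (All)
open import Data.List.Relation.Unary.AllPairs using (AllPairs)
open import Data.Nat.Base as ℕ using (ℕ; zero; suc)
import Data.Nat.Properties as ℕ
open import Data.Product.Base using (∃; _×_; _,_; proj₁; proj₂; swap)
open import Data.Rational as ℚ using (ℚ; 0ℚ; 1ℚ; ½)
import Data.Rational.Properties as ℚ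
open import Data.Rational.Solver using (module +-*-Solver)
import Data.Unit.Base as Unit
open import Data.Vec.Base using (Vec; []; _∷_)
open import Function.Base using (id; _∘_; const)
open import Level using (Level; 0ℓ) renaming (suc to lsuc; _⊔_ to _⊔ˡ_)
open import Relation.Binary.Bundles using (Poset)
import Relation.Binary.Lattice as Order
import Relation.Binary.Lattice.Properties.Lattice as OrderLattice
import Relation.Binary.Lattice.Properties.DistributiveLattice as OrderDistributive
open import Relation.Binary.PropositionalEquality
  using (_≡_; refl; sym; trans; cong; cong₂; subst; subst₂; module ≡-Reasoning)
open import Relation.Nullary.Decidable using (does)
open import Relation.Nullary.Negation using (¬_)
open import Relation.Unary using (Pred; _∈_; _∩_; _⊆_; _≐_)

private
  variable
    c c′ ℓ ℓ′ : Level

------------------------------------------------------------------------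
-- Linear arithmetic over ℚ

module _ where
  open +-*-Solver

  p+[q-p] : ∀ p q → p ℚ.+ (q ℚ.- p) ≡ q
  p+[q-p] = solve 2 (λ p q → p :+ (q :- p) := q) refl

  [q-p]+p : ∀ p q → (q ℚ.- p) ℚ.+ p ≡ q
  [q-p]+p = solve 2 (λ p q → (q :- p) :+ p := q) refl

p<p+d : ∀ p {d} → 0ℚ ℚ.< d → p ℚ.< p ℚ.+ d
p<p+d p {d} 0<d = subst (ℚ._< p ℚ.+ d) (ℚ.+-identityʳ p) (ℚ.+-monoʳ-< p 0<d)

p<q⇒0<q-p : ∀ {p q} → p ℚ.< q → 0ℚ ℚ.< q ℚ.- p
p<q⇒0<q-p {p} {q} p<q = subst (ℚ._< q ℚ.- p) (ℚ.+-inverseʳ p) (ℚ.+-monoˡ-< (ℚ.- p) p<q)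

p<q⇒p-q<0 : ∀ {p q} → p ℚ.< q → p ℚ.- q ℚ.< 0ℚ
p<q⇒p-q<0 {p} {q} p<q = subst (p ℚ.- q ℚ.<_) (ℚ.+-inverseʳ q) (ℚ.+-monoˡ-< (ℚ.- q) p<q)

0<½p : ∀ {p} → 0ℚ ℚ.< p → 0ℚ ℚ.< ½ ℚ.* p
0<½p {p} 0<p = subst (ℚ._< ½ ℚ.* p) (ℚ.*-zeroʳ ½) (ℚ.*-monoʳ-<-pos ½ 0<p)

½p+½p : ∀ p → ½ ℚ.* p ℚ.+ ½ ℚ.* p ≡ p
½p+½p p = trans (sym (ℚ.*-distribʳ-+ p ½ ½)) (ℚ.*-identityˡ p)

------------------------------------------------------------------------
-- Dedekind reals

-- `tight` is the arithmetical form of locatedness.  Given the other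
-- fields, it is equivalent to the conjunction of inhabitedness of both
-- cuts and  p < q → p ∈ L ⊎ q ∈ U.
record ℝ : Set₁ where
  field
    L U      : Pred ℚ 0ℓ
    L-lower  : ∀ {p q} → p ℚ.< q → q ∈ L → p ∈ L
    L-open   : ∀ {p} → p ∈ L → ∃ λ q → p ℚ.< q × q ∈ L
    U-upper  : ∀ {p q} → p ℚ.< q → p ∈ U → q ∈ U
    U-open   : ∀ {q} → q ∈ U → ∃ λ p → p ℚ.< q × p ∈ U
    disjoint : ∀ {p q} → p ∈ L → q ∈ U → p ℚ.< q
    tight    : ∀ {ε} → 0ℚ ℚ.< ε → ∃ λ q → q ∈ L × (q ℚ.+ ε) ∈ U

open ℝ public using (L; U)

infix 4 _≤ᴿ_ _<ᴿ_ _≈ᴿ_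
infixl 6 _+ᴿ_

-- Each cut determines the other, so comparing lower cuts suffices: see
-- ≤ᴿ⇒U⊇ and U⊇⇒≤ᴿ.
_≤ᴿ_ : ℝ → ℝ → Set
x ≤ᴿ y = L x ⊆ L y

_<ᴿ_ : ℝ → ℝ → Set
x <ᴿ y = ∃ λ q → q ∈ U x × q ∈ L y

_≈ᴿ_ : ℝ → ℝ → Set
x ≈ᴿ y = x ≤ᴿ y × y ≤ᴿ x

fromℚ : ℚ → ℝ
fromℚ r = record
  { L        = ℚ._< r
  ; U        = r ℚ.<_
  ; L-lower  = ℚ.<-trans
  ; L-open   = λ p<r → let q , p<q , q<r = ℚ.<-dense p<r in q , p<q , q<r
  ; U-upper  = λ p<q r<p → ℚ.<-trans r<p p<q
  ; U-open   = λ r<q → let p , r<p , p<q = ℚ.<-dense r<q in p , p<q , r<p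
  ; disjoint = ℚ.<-trans
  ; tight    = λ {ε} 0<ε →
      let 0<δ = 0<½p 0<ε
          r-δ<r = subst (r ℚ.- ½ ℚ.* ε ℚ.<_) (lem₁ r (½ ℚ.* ε)) (p<p+d (r ℚ.- ½ ℚ.* ε) 0<δ)
      in r ℚ.- ½ ℚ.* ε , r-δ<r ,
         subst (r ℚ.<_) (lem₂ r ε) (p<p+d r 0<δ)
  }
  where
  open +-*-Solver
  lem₁ : ∀ r d → (r ℚ.- d) ℚ.+ d ≡ r
  lem₁ = solve 2 (λ r d → (r :- d) :+ d := r) refl
  lem₂ : ∀ r e → r ℚ.+ ½ ℚ.* e ≡ (r ℚ.- ½ ℚ.* e) ℚ.+ e
  lem₂ r e = trans (lem₃ r (½ ℚ.* e))
                   (cong ((r ℚ.- ½ ℚ.* e) ℚ.+_) (½p+½p e))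
    where
    lem₃ : ∀ r d → r ℚ.+ d ≡ (r ℚ.- d) ℚ.+ (d ℚ.+ d)
    lem₃ = solve 2 (λ r d → r :+ d := (r :- d) :+ (d :+ d)) refl

0ᴿ 1ᴿ : ℝ
0ᴿ = fromℚ 0ℚ
1ᴿ = fromℚ 1ℚ

_+ᴿ_ : ℝ → ℝ → ℝ
x +ᴿ y = record
  { L        = λ r → ∃ λ p → ∃ λ q → p ∈ L x × q ∈ L y × p ℚ.+ q ≡ r
  ; U        = λ r → ∃ λ p → ∃ λ q → p ∈ U x × q ∈ U y × p ℚ.+ q ≡ r
  ; L-lower  = λ {s} {r} s<r (p , q , p∈ , q∈ , p+q≡r) →
      s ℚ.- q , q ,
      x.L-lower (subst (s ℚ.- q ℚ.<_) (trans (cong (ℚ._- q) (sym p+q≡r)) (cancel p q))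
                  (ℚ.+-monoˡ-< (ℚ.- q) s<r)) p∈ ,
      q∈ , [q-p]+p q s
  ; L-open   = λ { (p , q , p∈ , q∈ , refl) →
      let p′ , p<p′ , p′∈ = x.L-open p∈
      in p′ ℚ.+ q , ℚ.+-monoˡ-< q p<p′ , (p′ , q , p′∈ , q∈ , refl) }
  ; U-upper  = λ {r} {s} r<s (p , q , p∈ , q∈ , p+q≡r) →
      s ℚ.- q , q ,
      x.U-upper (subst (ℚ._< s ℚ.- q) (trans (cong (ℚ._- q) (sym p+q≡r)) (cancel p q))
                  (ℚ.+-monoˡ-< (ℚ.- q) r<s)) p∈ ,
      q∈ , [q-p]+p q s
  ; U-open   = λ { (p , q , p∈ , q∈ , refl) →
      let p′ , p′<p , p′∈ = x.U-open p∈
      in p′ ℚ.+ q , ℚ.+-monoˡ-< q p′<p , (p′ , q , p′∈ , q∈ , refl) }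
  ; disjoint = λ { (p , q , p∈ , q∈ , refl) (p′ , q′ , p′∈ , q′∈ , refl) →
      ℚ.+-mono-< (x.disjoint p∈ p′∈) (y.disjoint q∈ q′∈) }
  ; tight    = λ {ε} 0<ε →
      let p , p∈ , p+∈ = x.tight (0<½p 0<ε)
          q , q∈ , q+∈ = y.tight (0<½p 0<ε)
      in p ℚ.+ q , (p , q , p∈ , q∈ , refl) ,
         (p ℚ.+ ½ ℚ.* ε , q ℚ.+ ½ ℚ.* ε , p+∈ , q+∈ ,
          trans (rearrange p q (½ ℚ.* ε)) (cong ((p ℚ.+ q) ℚ.+_) (½p+½p ε)))
  }
  where
  module x = ℝ x
  module y = ℝ y
  open +-*-Solver
  cancel : ∀ p q → (p ℚ.+ q) ℚ.- q ≡ p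
  cancel = solve 2 (λ p q → (p :+ q) :- q := p) refl
  rearrange : ∀ p q d → (p ℚ.+ d) ℚ.+ (q ℚ.+ d) ≡ (p ℚ.+ q) ℚ.+ (d ℚ.+ d)
  rearrange = solve 3 (λ p q d → (p :+ d) :+ (q :+ d) := (p :+ q) :+ (d :+ d)) refl

-- Constructive suprema and infima: bounds that can be approximated by
-- members of the family.  Classically these are least upper bounds and
-- greatest lower bounds.
IsSup : {I : Set c} → (I → ℝ) → ℝ → Set (lsuc 0ℓ ⊔ˡ c)
IsSup f s = (∀ i → f i ≤ᴿ s) × (∀ {x} → x <ᴿ s → ∃ λ i → x <ᴿ f i)

IsInf : {I : Set c} → (I → ℝ) → ℝ → Set (lsuc 0ℓ ⊔ˡ c)
IsInf f s = (∀ i → s ≤ᴿ f i) × (∀ {x} → s <ᴿ x → ∃ λ i → f i <ᴿ x)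

≤ᴿ⇒U⊇ : ∀ x y → x ≤ᴿ y → U y ⊆ U x
≤ᴿ⇒U⊇ x y x≤y {q} q∈Uy =
  let q′ , q′<q , q′∈Uy = ℝ.U-open y q∈Uy
      t , t∈Lx , t+∈Ux = ℝ.tight x (p<q⇒0<q-p q′<q)
      t<q′ = ℝ.disjoint y (x≤y t∈Lx) q′∈Uy
  in ℝ.U-upper x (subst (t ℚ.+ (q ℚ.- q′) ℚ.<_) (p+[q-p] q′ q)
       (ℚ.+-monoˡ-< (q ℚ.- q′) t<q′)) t+∈Ux

U⊇⇒≤ᴿ : ∀ x y → U y ⊆ U x → x ≤ᴿ y
U⊇⇒≤ᴿ x y Uy⊆Ux {p} p∈Lx =
  let p′ , p<p′ , p′∈Lx = ℝ.L-open x p∈Lx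
      t , t∈Ly , t+∈Uy = ℝ.tight y (p<q⇒0<q-p p<p′)
      p′<t+ = ℝ.disjoint x p′∈Lx (Uy⊆Ux t+∈Uy)
      p<t = subst₂ ℚ._<_ (lem₁ p p′) (lem₂ t p p′) (ℚ.+-monoˡ-< (ℚ.- (p′ ℚ.- p)) p′<t+)
  in ℝ.L-lower y p<t t∈Ly
  where
  open +-*-Solver
  lem₁ : ∀ p p′ → p′ ℚ.- (p′ ℚ.- p) ≡ p
  lem₁ = solve 2 (λ p p′ → p′ :- (p′ :- p) := p) refl
  lem₂ : ∀ t p p′ → (t ℚ.+ (p′ ℚ.- p)) ℚ.- (p′ ℚ.- p) ≡ t
  lem₂ = solve 3 (λ t p p′ → (t :+ (p′ :- p)) :- (p′ :- p) := t) refl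

x≤x+y : ∀ x y → 0ᴿ ≤ᴿ y → x ≤ᴿ x +ᴿ y
x≤x+y x y 0≤y {p} p∈Lx =
  let q , p<q , q∈Lx = ℝ.L-open x p∈Lx
  in q , p ℚ.- q , q∈Lx , 0≤y (p<q⇒p-q<0 p<q) , p+[q-p] q p

-- If x + y ≤ z, p < x and z < q then y < q - p.
difference : ∀ x y z → x +ᴿ y ≤ᴿ z → ∀ {p δ} → p ∈ L x → (p ℚ.+ δ) ∈ U z → δ ∈ U y
difference x y z x+y≤z {p} {δ} p∈Lx p+δ∈Uz =
  let p′ , p<p′ , p′∈Lx = ℝ.L-open x p∈Lx
      t , t∈Ly , t+∈Uy = ℝ.tight y (p<q⇒0<q-p p<p′)
      p′+t<p+δ = ℝ.disjoint z (x+y≤z (p′ , t , p′∈Lx , t∈Ly , refl)) p+δ∈Uz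
  in ℝ.U-upper y (subst₂ ℚ._<_ (lem₁ p p′ t) (lem₂ p δ)
       (ℚ.+-monoˡ-< (ℚ.- p) p′+t<p+δ)) t+∈Uy
  where
  open +-*-Solver
  lem₁ : ∀ p p′ t → (p′ ℚ.+ t) ℚ.- p ≡ t ℚ.+ (p′ ℚ.- p)
  lem₁ = solve 3 (λ p p′ t → (p′ :+ t) :- p := t :+ (p′ :- p)) refl
  lem₂ : ∀ p δ → (p ℚ.+ δ) ℚ.- p ≡ δ
  lem₂ = solve 2 (λ p δ → (p :+ δ) :- p := δ) refl

-- If z ≤ x + y, q > x and p < z then y > p - q.
difference′ : ∀ x y z → z ≤ᴿ x +ᴿ y → ∀ {p q} → q ∈ U x → p ∈ L z → (p ℚ.- q) ∈ L y
difference′ x y z z≤x+y {p} {q} q∈Ux p∈Lz =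
  let r , s , r∈Lx , s∈Ly , r+s≡p = z≤x+y p∈Lz
      r<q = ℝ.disjoint x r∈Lx q∈Ux
  in ℝ.L-lower y (subst₂ ℚ._<_ (trans (lem₁ r s q) (cong (ℚ._- q) r+s≡p)) (lem₂ s q)
       (ℚ.+-monoˡ-< (s ℚ.- q) r<q)) s∈Ly
  where
  open +-*-Solver
  lem₁ : ∀ r s q → r ℚ.+ (s ℚ.- q) ≡ (r ℚ.+ s) ℚ.- q
  lem₁ = solve 3 (λ r s q → r :+ (s :- q) := (r :+ s) :- q) refl
  lem₂ : ∀ s q → q ℚ.+ (s ℚ.- q) ≡ s
  lem₂ = solve 2 (λ s q → q :+ (s :- q) := s) refl

------------------------------------------------------------------------
-- Measures on Boolean algebras

record Measure (B : BooleanAlgebra c ℓ) : Set (lsuc 0ℓ ⊔ˡ c ⊔ˡ ℓ) where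
  open BooleanAlgebra B
  field
    measure      : Carrier → ℝ
    measure-cong : ∀ {a b} → a ≈ b → measure a ≈ᴿ measure b
    nonNeg       : ∀ a → 0ᴿ ≤ᴿ measure a
    unit         : measure ⊤ ≈ᴿ 1ᴿ
    additive     : ∀ a b → a ∧ b ≈ ⊥ → measure (a ∨ b) ≈ᴿ measure a +ᴿ measure b

module _ {B : BooleanAlgebra c ℓ} (μ : Measure B) where
  open BooleanAlgebra B renaming (¬_ to ∁_)
  open Measure μ

  StrictlyPositive : Set (c ⊔ˡ ℓ)
  StrictlyPositive = ∀ a → ¬ (a ≈ ⊥) → 0ᴿ <ᴿ measure a

  NonAtomic : Set (lsuc 0ℓ ⊔ˡ c ⊔ˡ ℓ)
  NonAtomic = ∀ ε → 0ᴿ <ᴿ ε → ∃ λ (as : List Carrier) →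
    AllPairs (λ a b → a ∧ b ≈ ⊥) as ×
    foldr _∨_ ⊥ as ≈ ⊤ ×
    All (λ a → measure a ≤ᴿ ε) as

-- A Boolean isomorphism preserves finitary operations only; suprema and
-- infima of infinite families need not be preserved.
record MetricIsomorphism (A : BooleanAlgebra c ℓ) (μ : Measure A)
                         (B : BooleanAlgebra c′ ℓ′) (ν : Measure B) :
                         Set (lsuc 0ℓ ⊔ˡ c ⊔ˡ ℓ ⊔ˡ c′ ⊔ˡ ℓ′) where
  private
    module A = BooleanAlgebra A
    module B = BooleanAlgebra B
    module μ = Measure μ
    module ν = Measure ν
  field
    to                   : A.Carrier → B.Carrier
    isLatticeIsomorphism : IsLatticeIsomorphism A.rawLattice B.rawLattice to
    ⊤-homo               : to A.⊤ B.≈ B.⊤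
    ⊥-homo               : to A.⊥ B.≈ B.⊥
    ¬-homo               : ∀ a → to (A.¬ a) B.≈ B.¬ (to a)
    measure-preserving   : ∀ a → ν.measure (to a) ≈ᴿ μ.measure a

------------------------------------------------------------------------
-- The completion of a Boolean algebra

module Completion (B : BooleanAlgebra 0ℓ 0ℓ) where
  open BooleanAlgebra B hiding (sym; trans) renaming (refl to ≈-refl; ¬_ to ∁_)
  open BooleanAlgebra B using () renaming (sym to ≈-sym; trans to ≈-trans)
  open BooleanProperties B
  open Poset poset public using (_≤_)
  private module ≤ = Poset poset

  infix 9 _⊥ᵖ

  _⊥ᵖ : Pred Carrier 0ℓ → Pred Carrier 0ℓ
  (P ⊥ᵖ) b = ∀ {a} → a ∈ P → a ∧ b ≈ ⊥

  P⊆P⊥⊥ : ∀ P → P ⊆ (P ⊥ᵖ) ⊥ᵖ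
  P⊆P⊥⊥ P b∈P a∈P⊥ = ≈-trans (∧-comm _ _) (a∈P⊥ b∈P)

  antitone : ∀ {P Q} → P ⊆ Q → Q ⊥ᵖ ⊆ P ⊥ᵖ
  antitone P⊆Q b∈Q⊥ a∈P = b∈Q⊥ (P⊆Q a∈P)

  ⊥ᵖ-lower : ∀ P {x y} → x ≤ y → y ∈ P ⊥ᵖ → x ∈ P ⊥ᵖ
  ⊥ᵖ-lower P {x} {y} x≤y y∈ {a} a∈P = begin
    a ∧ x        ≈⟨ ∧-congˡ x≤y ⟩
    a ∧ (x ∧ y)  ≈⟨ ∧-congˡ (∧-comm x y) ⟩
    a ∧ (y ∧ x)  ≈⟨ ∧-assoc a y x ⟨
    (a ∧ y) ∧ x  ≈⟨ ∧-congʳ (y∈ a∈P) ⟩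
    ⊥ ∧ x        ≈⟨ ∧-zeroˡ x ⟩
    ⊥            ∎
    where open import Relation.Binary.Reasoning.Setoid setoid

  -- The elements of the completion are the ideals I with I = I⊥⊥.  (Being
  -- an ideal follows from the equation.)  These are the normal ideals of
  -- the Dedekind–MacNeille completion, or equally the regular open
  -- subsets of the Stone space of B.
  record RegularIdeal : Set₁ where
    field
      ideal   : Pred Carrier 0ℓ
      regular : (ideal ⊥ᵖ) ⊥ᵖ ⊆ ideal

  open RegularIdeal public

  lower : ∀ I {x y} → x ≤ y → y ∈ ideal I → x ∈ ideal I
  lower I x≤y y∈I = regular I (⊥ᵖ-lower (ideal I ⊥ᵖ) x≤y (P⊆P⊥⊥ (ideal I) y∈I))

  infix  4 _⊑_ _≋_
  infixr 7 _⊓_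
  infixr 6 _⊔_
  infix  8 ~_

  _⊑_ : RegularIdeal → RegularIdeal → Set
  I ⊑ J = ideal I ⊆ ideal J

  _≋_ : RegularIdeal → RegularIdeal → Set
  I ≋ J = ideal I ≐ ideal J

  polar : Pred Carrier 0ℓ → RegularIdeal
  polar P = record { ideal = P ⊥ᵖ ; regular = antitone (P⊆P⊥⊥ P) }

  ~_ : RegularIdeal → RegularIdeal
  ~ I = polar (ideal I)

  _⊓_ : RegularIdeal → RegularIdeal → RegularIdeal
  I ⊓ J = record
    { ideal   = ideal I ∩ ideal J
    ; regular = λ x∈ → regular I (antitone (antitone proj₁) x∈)
                     , regular J (antitone (antitone proj₂) x∈)
    }

  _⊔_ : RegularIdeal → RegularIdeal → RegularIdeal
  I ⊔ J = ~ (~ I ⊓ ~ J)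

  𝟙 : RegularIdeal
  𝟙 = record { ideal = λ _ → Unit.⊤ ; regular = λ _ → Unit.tt }

  𝟘 : RegularIdeal
  𝟘 = record
    { ideal   = _≈ ⊥
    ; regular = λ {x} x∈ → ≈-trans (≈-sym (∧-identityˡ x))
                             (x∈ {⊤} (λ y≈⊥ → ≈-trans (∧-identityʳ _) y≈⊥))
    }

  𝟘-least : ∀ I → 𝟘 ⊑ I
  𝟘-least I x≈⊥ = regular I (λ _ → ≈-trans (∧-congˡ x≈⊥) (∧-zeroʳ _))

  embed : Carrier → RegularIdeal
  embed b = record
    { ideal   = _≤ b
    ; regular = λ {x} x∈ → disjoint⇒≤ x b (x∈ {∁ b} (λ y≤b → ≤⇒disjoint _ b y≤b))
    }
    where
    open import Relation.Binary.Reasoning.Setoid setoid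
    ≤⇒disjoint : ∀ y b → y ≤ b → y ∧ ∁ b ≈ ⊥
    ≤⇒disjoint y b y≤b = begin
      y ∧ ∁ b        ≈⟨ ∧-congʳ y≤b ⟩
      (y ∧ b) ∧ ∁ b  ≈⟨ ∧-assoc y b (∁ b) ⟩
      y ∧ (b ∧ ∁ b)  ≈⟨ ∧-congˡ (∧-complementʳ b) ⟩
      y ∧ ⊥          ≈⟨ ∧-zeroʳ y ⟩
      ⊥              ∎
    disjoint⇒≤ : ∀ x b → ∁ b ∧ x ≈ ⊥ → x ≤ b
    disjoint⇒≤ x b d = begin
      x                    ≈⟨ ∧-identityʳ x ⟨
      x ∧ ⊤                ≈⟨ ∧-congˡ (∨-complementʳ b) ⟨
      x ∧ (b ∨ ∁ b)        ≈⟨ ∧-distribˡ-∨ x b (∁ b) ⟩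
      (x ∧ b) ∨ (x ∧ ∁ b)  ≈⟨ ∨-congˡ (≈-trans (∧-comm x (∁ b)) d) ⟩
      (x ∧ b) ∨ ⊥          ≈⟨ ∨-identityʳ (x ∧ b) ⟩
      x ∧ b                ∎

  embed-mono : ∀ {a b} → a ≤ b → embed a ⊑ embed b
  embed-mono a≤b x≤a = ≤.trans x≤a a≤b

  embed-cancel : ∀ {a b} → embed a ⊑ embed b → a ≤ b
  embed-cancel a⊑b = a⊑b ≤.refl

  ⊔-upperˡ : ∀ I J → I ⊑ I ⊔ J
  ⊔-upperˡ I J x∈I (a∈~I , _) = P⊆P⊥⊥ (ideal I) x∈I a∈~I

  ⊔-upperʳ : ∀ I J → J ⊑ I ⊔ J
  ⊔-upperʳ I J x∈J (_ , a∈~J) = P⊆P⊥⊥ (ideal J) x∈J a∈~J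

  ⊔-least : ∀ I J K → I ⊑ K → J ⊑ K → I ⊔ J ⊑ K
  ⊔-least I J K I⊑K J⊑K x∈ =
    regular K (λ a∈~K → x∈ (antitone I⊑K a∈~K , antitone J⊑K a∈~K))

  embed-∨ : ∀ b c I → embed b ⊑ I → embed c ⊑ I → embed (b ∨ c) ⊑ I
  embed-∨ b c I b⊑I c⊑I x≤b∨c = lower I x≤b∨c (regular I λ {a} a∈~I →
    ≈-trans (∧-distribˡ-∨ a b c)
      (≈-trans (∨-cong (≈-trans (∧-comm a b) (a∈~I (b⊑I ≤.refl)))
                       (≈-trans (∧-comm a c) (a∈~I (c⊑I ≤.refl))))
               (∨-identityʳ ⊥)))

  private
    latticeᵒ : Order.Lattice (lsuc 0ℓ) 0ℓ 0ℓ
    latticeᵒ = record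
      { _≈_       = _≋_
      ; _≤_       = _⊑_
      ; _∨_       = _⊔_
      ; _∧_       = _⊓_
      ; isLattice = record
        { isPartialOrder = record
          { isPreorder = record
            { isEquivalence = record
              { refl  = id , id
              ; sym   = swap
              ; trans = λ (p , q) (r , s) → r ∘ p , q ∘ s
              }
            ; reflexive = proj₁
            ; trans     = λ p q → q ∘ p
            }
          ; antisym = _,_
          }
        ; supremum = λ I J → ⊔-upperˡ I J , ⊔-upperʳ I J , ⊔-least I J
        ; infimum  = λ I J → proj₁ , proj₂ , λ K p q x∈ → p x∈ , q x∈
        }
      }

  ⊓-distribˡ-⊔ : ∀ I J K → I ⊓ (J ⊔ K) ⊑ (I ⊓ J) ⊔ (I ⊓ K)
  ⊓-distribˡ-⊔ I J K {x} (x∈I , x∈J⊔K) {a} (a∈₁ , a∈₂) = begin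
    a ∧ x        ≈⟨ ∧-congˡ (∧-idem x) ⟨
    a ∧ (x ∧ x)  ≈⟨ ∧-assoc a x x ⟨
    (a ∧ x) ∧ x  ≈⟨ x∈J⊔K (below J a∈₁ , below K a∈₂) ⟩
    ⊥            ∎
    where
    open import Relation.Binary.Reasoning.Setoid setoid
    x∧b≤x : ∀ b → b ∧ x ≤ x
    x∧b≤x b = ≈-trans (∧-congˡ (≈-sym (∧-idem x))) (≈-sym (∧-assoc b x x))
    x∧b≤b : ∀ b → b ∧ x ≤ b
    x∧b≤b b = ≈-trans (∧-congʳ (≈-sym (∧-idem b)))
                (≈-trans (∧-assoc b b x) (∧-comm b (b ∧ x)))
    below : ∀ M → a ∈ (ideal I ∩ ideal M) ⊥ᵖ → (a ∧ x) ∈ ideal M ⊥ᵖ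
    below M a∈ {b} b∈M = begin
      b ∧ (a ∧ x)  ≈⟨ ∧-congˡ (∧-comm a x) ⟩
      b ∧ (x ∧ a)  ≈⟨ ∧-assoc b x a ⟨
      (b ∧ x) ∧ a  ≈⟨ a∈ (lower I (x∧b≤x b) x∈I , lower M (x∧b≤b b) b∈M) ⟩
      ⊥            ∎

  private
    distributiveᵒ : Order.DistributiveLattice (lsuc 0ℓ) 0ℓ 0ℓ
    distributiveᵒ = record
      { isDistributiveLattice = record
        { isLattice    = Order.Lattice.isLattice latticeᵒ
        ; ∧-distribˡ-∨ = λ I J K →
            ⊓-distribˡ-⊔ I J K ,
            ⊔-least (I ⊓ J) (I ⊓ K) (I ⊓ (J ⊔ K))
              (λ {x} (x∈I , x∈J) → x∈I , ⊔-upperˡ J K {x} x∈J)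
              (λ {x} (x∈I , x∈K) → x∈I , ⊔-upperʳ J K {x} x∈K)
        }
      }

  booleanAlgebra : BooleanAlgebra (lsuc 0ℓ) 0ℓ
  booleanAlgebra = record
    { Carrier          = RegularIdeal
    ; _≈_              = _≋_
    ; _∨_              = _⊔_
    ; _∧_              = _⊓_
    ; ¬_               = ~_
    ; ⊤                = 𝟙
    ; ⊥                = 𝟘
    ; isBooleanAlgebra = isBooleanAlgebraʳ (record
      { isDistributiveLattice = isDistributiveLatticeʳʲᵐ (record
        { isLattice    = OrderLattice.isAlgLattice latticeᵒ
        ; ∨-distribʳ-∧ = OrderDistributive.∨-distribʳ-∧ distributiveᵒ
        })
      ; ∨-complementʳ = λ I →
          (λ _ → Unit.tt) ,
          (λ _ (a∈~I , a∈~~I) → ∈~⇒≈⊥ (~ I) a∈~I a∈~~I)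
      ; ∧-complementʳ = λ I →
          (λ (x∈I , x∈~I) → ≈-trans (≈-sym (∧-idem _)) (x∈~I x∈I)) ,
          (λ x≈⊥ → 𝟘-least I x≈⊥ , 𝟘-least (~ I) x≈⊥)
      ; ¬-cong        = λ (I⊑J , J⊑I) → antitone J⊑I , antitone I⊑J
      })
    }
    where
    ∈~⇒≈⊥ : ∀ I {a b} → a ∈ ideal I → a ∈ ideal (~ I) → a ∧ b ≈ ⊥
    ∈~⇒≈⊥ I {a} {b} a∈I a∈~I =
      ≈-trans (∧-congʳ (≈-trans (≈-sym (∧-idem a)) (a∈~I a∈I))) (∧-zeroˡ b)

  dense : ∀ I → (∀ b → embed b ⊑ I → b ≈ ⊥) → I ≋ 𝟘
  dense I h = (λ {b} b∈I → h b (λ x≤b → lower I x≤b b∈I))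
            , 𝟘-least I

  ⨆ : {S : Set} → (S → RegularIdeal) → RegularIdeal
  ⨆ F = polar ((λ x → ∃ λ s → x ∈ ideal (F s)) ⊥ᵖ)

  ⨆-upper : {S : Set} (F : S → RegularIdeal) → ∀ s → F s ⊑ ⨆ F
  ⨆-upper F s x∈ a∈ = ≈-trans (∧-comm _ _) (a∈ (s , x∈))

  ⨆-least : {S : Set} (F : S → RegularIdeal) → ∀ J → (∀ s → F s ⊑ J) → ⨆ F ⊑ J
  ⨆-least F J h x∈ = regular J (λ a∈ → x∈ (λ (s , y∈) → a∈ (h s y∈)))

------------------------------------------------------------------------
-- The Jordan extension of a measure

module _ {B : BooleanAlgebra 0ℓ 0ℓ} (μ : Measure B) where
  open BooleanAlgebra B hiding (sym; trans) renaming (refl to ≈-refl; ¬_ to ∁_)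
  open BooleanAlgebra B using () renaming (sym to ≈-sym; trans to ≈-trans)
  open BooleanProperties B
  open Order.Lattice ∨-∧-orderTheoreticLattice
    using (x∧y≤x; x∧y≤y; x≤x∨y; y≤x∨y; ∨-least; ∧-greatest)
    renaming (refl to ≤-refl; trans to ≤-trans)
  open Completion B
  open Measure μ

  IsInnerMeasure : RegularIdeal → ℝ → Set₁
  IsInnerMeasure I = IsSup {I = ∃ λ b → embed b ⊑ I} (measure ∘ proj₁)

  IsOuterMeasure : RegularIdeal → ℝ → Set₁
  IsOuterMeasure I = IsInf {I = ∃ λ b → I ⊑ embed b} (measure ∘ proj₁)

  -- An element of 𝒥 is an element of the completion whose inner and outer
  -- measures are the same real.  That real is determined by the element
  -- (value-mono), so equality in 𝒥 is equality of elements of the completion.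
  record Jordan : Set₁ where
    field
      element : RegularIdeal
      value   : ℝ
      inner   : IsInnerMeasure element value
      outer   : IsOuterMeasure element value

  open Jordan public

  module _ where
    open import Relation.Binary.Reasoning.Setoid setoid

    _∖_ : Carrier → Carrier → Carrier
    a ∖ b = a ∧ ∁ b

    b∧[c∖b] : ∀ b c → b ∧ (c ∖ b) ≈ ⊥
    b∧[c∖b] b c = begin
      b ∧ (c ∧ ∁ b)  ≈⟨ ∧-congˡ (∧-comm c (∁ b)) ⟩
      b ∧ (∁ b ∧ c)  ≈⟨ ∧-assoc b (∁ b) c ⟨
      (b ∧ ∁ b) ∧ c  ≈⟨ ∧-congʳ (∧-complementʳ b) ⟩
      ⊥ ∧ c          ≈⟨ ∧-zeroˡ c ⟩
      ⊥              ∎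

    b∨[c∖b] : ∀ b c → b ∨ (c ∖ b) ≈ b ∨ c
    b∨[c∖b] b c = begin
      b ∨ (c ∧ ∁ b)        ≈⟨ ∨-distribˡ-∧ b c (∁ b) ⟩
      (b ∨ c) ∧ (b ∨ ∁ b)  ≈⟨ ∧-congˡ (∨-complementʳ b) ⟩
      (b ∨ c) ∧ ⊤          ≈⟨ ∧-identityʳ (b ∨ c) ⟩
      b ∨ c                ∎

    ≤⇒∨≈ : ∀ {b c} → b ≤ c → b ∨ c ≈ c
    ≤⇒∨≈ {b} {c} b≤c = begin
      b ∨ c        ≈⟨ ∨-congʳ b≤c ⟩
      (b ∧ c) ∨ c  ≈⟨ ∨-comm (b ∧ c) c ⟩
      c ∨ (b ∧ c)  ≈⟨ ∨-congˡ (∧-comm b c) ⟩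
      c ∨ (c ∧ b)  ≈⟨ ∨-absorbs-∧ c b ⟩
      c            ∎

    meet-difference : ∀ b b′ c c′ →
      (c ∧ c′) ∖ (b ∧ b′) ≤ (c ∖ b) ∨ (c′ ∖ b′)
    meet-difference b b′ c c′ = ≤-trans (≤-reflexive lem) (∨-least
      (≤-trans (∧-greatest (≤-trans (x∧y≤x _ _) (x∧y≤x _ _)) (x∧y≤y _ _)) (x≤x∨y _ _))
      (≤-trans (∧-greatest (≤-trans (x∧y≤x _ _) (x∧y≤y _ _)) (x∧y≤y _ _)) (y≤x∨y _ _)))
      where
      open Order.Lattice ∨-∧-orderTheoreticLattice using () renaming (reflexive to ≤-reflexive)
      lem : (c ∧ c′) ∖ (b ∧ b′) ≈ ((c ∧ c′) ∧ ∁ b) ∨ ((c ∧ c′) ∧ ∁ b′)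
      lem = ≈-trans (∧-congˡ (deMorgan₁ b b′)) (∧-distribˡ-∨ _ _ _)

  split : ∀ {b c} → b ≤ c → measure c ≈ᴿ measure b +ᴿ measure (c ∖ b)
  split {b} {c} b≤c =
    let c≤ , ≤c = measure-cong (≈-trans (b∨[c∖b] b c) (≤⇒∨≈ b≤c))
        p , q = additive b (c ∖ b) (b∧[c∖b] b c)
    in p ∘ ≤c , c≤ ∘ q

  monotone : ∀ {b c} → b ≤ c → measure b ≤ᴿ measure c
  monotone {b} {c} b≤c =
    proj₂ (split b≤c) ∘ x≤x+y (measure b) (measure (c ∖ b)) (nonNeg (c ∖ b))

  subadditive : ∀ b c {p q} → p ∈ U (measure b) → q ∈ U (measure c) →
                (p ℚ.+ q) ∈ U (measure (b ∨ c))
  subadditive b c {p} {q} p∈ q∈ =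
    ≤ᴿ⇒U⊇ (measure (b ∨ c)) (measure b +ᴿ measure (c ∖ b))
      (proj₁ (additive b (c ∖ b) (b∧[c∖b] b c)) ∘ proj₂ (measure-cong (b∨[c∖b] b c)))
      (p , q , p∈ ,
       ≤ᴿ⇒U⊇ (measure (c ∖ b)) (measure c) (monotone (x∧y≤x c (∁ b))) q∈ , refl)

  𝟙≋embed-⊤ : 𝟙 ≋ embed ⊤
  𝟙≋embed-⊤ = (λ {x} _ → ≈-sym (∧-identityʳ x)) , (λ _ → Unit.tt)

  𝟘≋embed-⊥ : 𝟘 ≋ embed ⊥
  𝟘≋embed-⊥ = 𝟘-least (embed ⊥) , (λ {x} x≤⊥ → ≈-trans x≤⊥ (∧-zeroʳ x))

  -- `Squeezed I` says that μ_* I = μ^* I without naming the common value.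
  Squeezed : RegularIdeal → Set
  Squeezed I = ∀ ε → 0ℚ ℚ.< ε → ∃ λ b → ∃ λ c → ∃ λ q →
    embed b ⊑ I × I ⊑ embed c × q ∈ L (measure b) × (q ℚ.+ ε) ∈ U (measure c)

  squeezed⇒jordan : ∀ I → Squeezed I → Jordan
  squeezed⇒jordan I sq = record
    { element = I
    ; value   = v
    ; inner   = (λ (b , b⊑I) p∈ → b , b⊑I , p∈)
              , (λ (q , q∈Ux , b , b⊑I , q∈Lb) → (b , b⊑I) , q , q∈Ux , q∈Lb)
    ; outer   = (λ (c , I⊑c) → U⊇⇒≤ᴿ v (measure c) (λ q∈ → c , I⊑c , q∈))
              , (λ (q , (c , I⊑c , q∈Uc) , q∈Lx) → (c , I⊑c) , q , q∈Uc , q∈Lx)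
    }
    where
    v : ℝ
    v = record
      { L        = λ q → ∃ λ b → embed b ⊑ I × q ∈ L (measure b)
      ; U        = λ q → ∃ λ c → I ⊑ embed c × q ∈ U (measure c)
      ; L-lower  = λ p<q (b , b⊑I , q∈) → b , b⊑I , ℝ.L-lower (measure b) p<q q∈
      ; L-open   = λ (b , b⊑I , p∈) →
          let q , p<q , q∈ = ℝ.L-open (measure b) p∈ in q , p<q , b , b⊑I , q∈
      ; U-upper  = λ p<q (c , I⊑c , p∈) → c , I⊑c , ℝ.U-upper (measure c) p<q p∈
      ; U-open   = λ (c , I⊑c , q∈) →
          let p , p<q , p∈ = ℝ.U-open (measure c) q∈ in p , p<q , c , I⊑c , p∈
      ; disjoint = λ (b , b⊑I , p∈) (c , I⊑c , q∈) →
          ℝ.disjoint (measure c) (monotone (embed-cancel {b} {c} (I⊑c ∘ b⊑I)) p∈) q∈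
      ; tight    = λ {ε} 0<ε →
          let b , c , q , b⊑I , I⊑c , q∈ , q+ε∈ = sq ε 0<ε
          in q , (b , b⊑I , q∈) , (c , I⊑c , q+ε∈)
      }

  module _ (J : Jordan) where

    inner-approx : ∀ {p} → p ∈ L (value J) →
                   ∃ λ b → embed b ⊑ element J × p ∈ L (measure b)
    inner-approx {p} p∈ =
      let q , p<q , q∈ = ℝ.L-open (value J) p∈
          (b , b⊑J) , r , p<r , r∈ = proj₂ (inner J) {fromℚ p} (q , p<q , q∈)
      in b , b⊑J , ℝ.L-lower (measure b) p<r r∈

    outer-approx : ∀ {q} → q ∈ U (value J) →
                   ∃ λ c → element J ⊑ embed c × q ∈ U (measure c)
    outer-approx {q} q∈ =
      let p , p<q , p∈ = ℝ.U-open (value J) q∈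
          (c , J⊑c) , r , r∈ , r<q = proj₂ (outer J) {fromℚ q} (p , p∈ , p<q)
      in c , J⊑c , ℝ.U-upper (measure c) r<q r∈

    jordan⇒squeezed : Squeezed (element J)
    jordan⇒squeezed ε 0<ε =
      let q , q∈ , q+ε∈ = ℝ.tight (value J) 0<ε
          b , b⊑J , q∈b = inner-approx q∈
          c , J⊑c , q+ε∈c = outer-approx q+ε∈
      in b , c , q , b⊑J , J⊑c , q∈b , q+ε∈c

  squeezed-embed : ∀ b → Squeezed (embed b)
  squeezed-embed b ε 0<ε =
    let q , q∈ , q+ε∈ = ℝ.tight (measure b) 0<ε
    in b , b , q , id , id , q∈ , q+ε∈

  squeezed-≋ : ∀ I J → I ≋ J → Squeezed I → Squeezed J
  squeezed-≋ I J (I⊑J , J⊑I) sq ε 0<ε =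
    let b , c , q , b⊑I , I⊑c , rest = sq ε 0<ε
    in b , c , q , I⊑J ∘ b⊑I , I⊑c ∘ J⊑I , rest

  embed-∁ : ∀ b → ~ embed b ≋ embed (∁ b)
  embed-∁ b = (λ {x} x∈ → to x (x∈ ≤-refl)) , (λ {x} x≤∁b a≤b → from x≤∁b a≤b)
    where
    open import Relation.Binary.Reasoning.Setoid setoid
    to : ∀ x → b ∧ x ≈ ⊥ → x ≤ ∁ b
    to x d = begin
      x                    ≈⟨ ∧-identityʳ x ⟨
      x ∧ ⊤                ≈⟨ ∧-congˡ (∨-complementʳ b) ⟨
      x ∧ (b ∨ ∁ b)        ≈⟨ ∧-distribˡ-∨ x b (∁ b) ⟩
      (x ∧ b) ∨ (x ∧ ∁ b)  ≈⟨ ∨-congʳ (≈-trans (∧-comm x b) d) ⟩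
      ⊥ ∨ (x ∧ ∁ b)        ≈⟨ ∨-identityˡ (x ∧ ∁ b) ⟩
      x ∧ ∁ b              ∎
    from : ∀ {x a} → x ≤ ∁ b → a ≤ b → a ∧ x ≈ ⊥
    from {x} {a} x≤∁b a≤b = begin
      a ∧ x                  ≈⟨ ∧-cong a≤b x≤∁b ⟩
      (a ∧ b) ∧ (x ∧ ∁ b)    ≈⟨ ∧-assoc a b (x ∧ ∁ b) ⟩
      a ∧ (b ∧ (x ∧ ∁ b))    ≈⟨ ∧-congˡ (b∧[c∖b] b x) ⟩
      a ∧ ⊥                  ≈⟨ ∧-zeroʳ a ⟩
      ⊥                      ∎

  squeezed-~ : ∀ I → Squeezed I → Squeezed (~ I)
  squeezed-~ I sq ε 0<ε =
    let b , c , q , b⊑I , I⊑c , q∈ , q+h∈ = sq h 0<h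
    in ∁ c , ∁ b , (1ℚ ℚ.- k) ℚ.- (q ℚ.+ h) ,
       (λ x∈ → antitone I⊑c (proj₂ (embed-∁ c) x∈)) ,
       (λ x∈ → proj₁ (embed-∁ b) (antitone b⊑I x∈)) ,
       difference′ (measure c) (measure (∁ c)) 1ᴿ (proj₂ (total c)) q+h∈
         (subst (1ℚ ℚ.- k ℚ.<_) ([q-p]+p k 1ℚ) (p<p+d (1ℚ ℚ.- k) (0<½p 0<h))) ,
       difference (measure b) (measure (∁ b)) 1ᴿ (proj₁ (total b)) q∈
         (subst (1ℚ ℚ.<_) (lem q) (p<p+d 1ℚ (0<½p 0<h)))
    where
    h k : ℚ
    h = ½ ℚ.* ε
    k = ½ ℚ.* h
    0<h : 0ℚ ℚ.< h
    0<h = 0<½p 0<ε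
    total : ∀ a → measure a +ᴿ measure (∁ a) ≈ᴿ 1ᴿ
    total a =
      let p , r = additive a (∁ a) (∧-complementʳ a)
          s , t = measure-cong (∨-complementʳ a)
      in proj₁ unit ∘ s ∘ r , p ∘ t ∘ proj₂ unit
    lem : ∀ q → 1ℚ ℚ.+ k ≡ q ℚ.+ (((1ℚ ℚ.- k) ℚ.- (q ℚ.+ h)) ℚ.+ ε)
    lem q = begin
      1ℚ ℚ.+ k
        ≡⟨ lem₁ 1ℚ k h q ⟩
      q ℚ.+ (((1ℚ ℚ.- k) ℚ.- (q ℚ.+ h)) ℚ.+ (h ℚ.+ (k ℚ.+ k)))
        ≡⟨ cong (λ z → q ℚ.+ (((1ℚ ℚ.- k) ℚ.- (q ℚ.+ h)) ℚ.+ z))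
             (trans (cong (h ℚ.+_) (½p+½p h)) (½p+½p ε)) ⟩
      q ℚ.+ (((1ℚ ℚ.- k) ℚ.- (q ℚ.+ h)) ℚ.+ ε)
        ∎
      where
      open ≡-Reasoning
      open +-*-Solver
      lem₁ : ∀ u k h q → u ℚ.+ k ≡
             q ℚ.+ (((u ℚ.- k) ℚ.- (q ℚ.+ h)) ℚ.+ (h ℚ.+ (k ℚ.+ k)))
      lem₁ = solve 4 (λ u k h q →
        u :+ k := q :+ (((u :- k) :- (q :+ h)) :+ (h :+ (k :+ k)))) refl

  squeezed-⊓ : ∀ I J → Squeezed I → Squeezed J → Squeezed (I ⊓ J)
  squeezed-⊓ I J sqI sqJ ε 0<ε =
    let b , c , q , b⊑I , I⊑c , q∈ , q+k∈ = sqI k (0<½p 0<h)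
        b′ , c′ , q′ , b′⊑J , J⊑c′ , q′∈ , q′+k∈ = sqJ k (0<½p 0<h)
        x = b ∧ b′
        y = c ∧ c′
        b≤c = embed-cancel {b} {c} (I⊑c ∘ b⊑I)
        b′≤c′ = embed-cancel {b′} {c′} (J⊑c′ ∘ b′⊑J)
        x≤y = ∧-greatest (≤-trans (x∧y≤x b b′) b≤c) (≤-trans (x∧y≤y b b′) b′≤c′)
        t , t∈ , t+h∈ = ℝ.tight (measure x) 0<h
        k∈ = difference (measure b) (measure (c ∖ b)) (measure c)
               (proj₂ (split b≤c)) q∈ q+k∈
        k∈′ = difference (measure b′) (measure (c′ ∖ b′)) (measure c′)
               (proj₂ (split b′≤c′)) q′∈ q′+k∈
        h∈ = ≤ᴿ⇒U⊇ (measure (y ∖ x)) (measure ((c ∖ b) ∨ (c′ ∖ b′)))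
               (monotone (meet-difference b b′ c c′))
               (subadditive (c ∖ b) (c′ ∖ b′) k∈ k∈′)
        upper∈ = ≤ᴿ⇒U⊇ (measure y) (measure x +ᴿ measure (y ∖ x)) (proj₁ (split x≤y))
                   (t ℚ.+ h , k ℚ.+ k , t+h∈ , h∈ , lem t)
    in x , y , t ,
       (λ z≤x → b⊑I (≤-trans z≤x (x∧y≤x b b′)) , b′⊑J (≤-trans z≤x (x∧y≤y b b′))) ,
       (λ (z∈I , z∈J) → ∧-greatest (I⊑c z∈I) (J⊑c′ z∈J)) ,
       t∈ , upper∈
    where
    h k : ℚ
    h = ½ ℚ.* ε
    k = ½ ℚ.* h
    0<h : 0ℚ ℚ.< h
    0<h = 0<½p 0<ε
    lem : ∀ t → (t ℚ.+ h) ℚ.+ (k ℚ.+ k) ≡ t ℚ.+ ε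
    lem t = trans (ℚ.+-assoc t h (k ℚ.+ k))
              (cong (t ℚ.+_) (trans (cong (h ℚ.+_) (½p+½p h)) (½p+½p ε)))

  embedᴶ : Carrier → Jordan
  embedᴶ b = squeezed⇒jordan (embed b) (squeezed-embed b)

  ~ᴶ_ : Jordan → Jordan
  ~ᴶ J = squeezed⇒jordan (~ element J) (squeezed-~ (element J) (jordan⇒squeezed J))

  _⊓ᴶ_ : Jordan → Jordan → Jordan
  J ⊓ᴶ K = squeezed⇒jordan (element J ⊓ element K)
    (squeezed-⊓ (element J) (element K) (jordan⇒squeezed J) (jordan⇒squeezed K))

  _⊔ᴶ_ : Jordan → Jordan → Jordan
  J ⊔ᴶ K = squeezed⇒jordan (element J ⊔ element K)
    (squeezed-~ (~ element J ⊓ ~ element K)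
      (squeezed-⊓ (~ element J) (~ element K)
        (squeezed-~ (element J) (jordan⇒squeezed J))
        (squeezed-~ (element K) (jordan⇒squeezed K))))

  𝟙ᴶ : Jordan
  𝟙ᴶ = squeezed⇒jordan 𝟙 (squeezed-≋ (embed ⊤) 𝟙 (swap 𝟙≋embed-⊤) (squeezed-embed ⊤))

  𝟘ᴶ : Jordan
  𝟘ᴶ = squeezed⇒jordan 𝟘 (squeezed-≋ (embed ⊥) 𝟘 (swap 𝟘≋embed-⊥) (squeezed-embed ⊥))

  𝒥 : BooleanAlgebra (lsuc 0ℓ) 0ℓ
  𝒥 = record
    { Carrier          = Jordan
    ; _≈_              = λ J K → element J ≋ element K
    ; _∨_              = _⊔ᴶ_
    ; _∧_              = _⊓ᴶ_
    ; ¬_               = ~ᴶ_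
    ; ⊤                = 𝟙ᴶ
    ; ⊥                = 𝟘ᴶ
    ; isBooleanAlgebra = record
      { isDistributiveLattice = record
        { isLattice   = record
          { isEquivalence = record
            { refl  = λ {J} → ℭ.refl {element J}
            ; sym   = λ {J} {K} → ℭ.sym {element J} {element K}
            ; trans = λ {J} {K} {M} → ℭ.trans {element J} {element K} {element M}
            }
          ; ∨-comm     = λ J K → ℭ.∨-comm (element J) (element K)
          ; ∨-assoc    = λ J K M → ℭ.∨-assoc (element J) (element K) (element M)
          ; ∨-cong     = λ {J} {K} {M} {N} →
              ℭ.∨-cong {element J} {element K} {element M} {element N}
          ; ∧-comm     = λ J K → ℭ.∧-comm (element J) (element K)
          ; ∧-assoc    = λ J K M → ℭ.∧-assoc (element J) (element K) (element M)
          ; ∧-cong     = λ {J} {K} {M} {N} →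
              ℭ.∧-cong {element J} {element K} {element M} {element N}
          ; absorptive = (λ J K → ℭ.∨-absorbs-∧ (element J) (element K))
                       , (λ J K → ℭ.∧-absorbs-∨ (element J) (element K))
          }
        ; ∨-distrib-∧ = (λ J K M → ℭ.∨-distribˡ-∧ (element J) (element K) (element M))
                      , (λ J K M → ℭ.∨-distribʳ-∧ (element J) (element K) (element M))
        ; ∧-distrib-∨ = (λ J K M → ℭ.∧-distribˡ-∨ (element J) (element K) (element M))
                      , (λ J K M → ℭ.∧-distribʳ-∨ (element J) (element K) (element M))
        }
      ; ∨-complement = (λ J → ℭ.∨-complementˡ (element J))
                     , (λ J → ℭ.∨-complementʳ (element J))
      ; ∧-complement = (λ J → ℭ.∧-complementˡ (element J))
                     , (λ J → ℭ.∧-complementʳ (element J))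
      ; ¬-cong       = λ {J} {K} → ℭ.¬-cong {element J} {element K}
      }
    }
    where module ℭ = BooleanAlgebra booleanAlgebra

  value-mono : ∀ J K → element J ⊑ element K → value J ≤ᴿ value K
  value-mono J K J⊑K p∈ =
    let b , b⊑J , p∈b = inner-approx J p∈
    in proj₁ (inner K) (b , J⊑K ∘ b⊑J) p∈b

  value-embed : ∀ J {b} → element J ≋ embed b → value J ≈ᴿ measure b
  value-embed J {b} (J⊑b , b⊑J) = proj₁ (outer J) (b , J⊑b) , proj₁ (inner J) (b , b⊑J)

  value-additive : ∀ J K → element J ⊓ element K ≋ 𝟘 →
                   value (J ⊔ᴶ K) ≈ᴿ value J +ᴿ value K
  value-additive J K (d , _) =
    U⊇⇒≤ᴿ (value (J ⊔ᴶ K)) (value J +ᴿ value K) upper∈ ,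
    (λ {r} → lower∈ {r})
    where
    upper∈ : U (value J +ᴿ value K) ⊆ U (value (J ⊔ᴶ K))
    upper∈ (p , q , p∈ , q∈ , refl) =
      let b , J⊑b , p∈b = outer-approx J p∈
          c , K⊑c , q∈c = outer-approx K q∈
      in b ∨ c ,
         (⊔-least (element J) (element K) (embed (b ∨ c))
           (λ x∈ → ≤-trans (J⊑b x∈) (x≤x∨y b c))
           (λ x∈ → ≤-trans (K⊑c x∈) (y≤x∨y b c))) ,
         subadditive b c p∈b q∈c

    lower∈ : L (value J +ᴿ value K) ⊆ L (value (J ⊔ᴶ K))
    lower∈ (p , q , p∈ , q∈ , refl) =
      let b , b⊑J , p∈b = inner-approx J p∈
          c , c⊑K , q∈c = inner-approx K q∈
          b∧c≈⊥ = d (b⊑J (x∧y≤x b c) , c⊑K (x∧y≤y b c))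
      in b ∨ c ,
         embed-∨ b c (element J ⊔ element K)
           (λ {x} x≤b → ⊔-upperˡ (element J) (element K) {x} (b⊑J x≤b))
           (λ {x} x≤c → ⊔-upperʳ (element J) (element K) {x} (c⊑K x≤c)) ,
         proj₂ (additive b c b∧c≈⊥) (p , q , p∈b , q∈c , refl)

  μ̂ : Measure 𝒥
  μ̂ = record
    { measure      = value
    ; measure-cong = λ {J} {K} (J⊑K , K⊑J) → value-mono J K J⊑K , value-mono K J K⊑J
    ; nonNeg       = λ J →
        proj₁ (inner J) (⊥ , 𝟘-least (element J) ∘ proj₂ 𝟘≋embed-⊥) ∘ nonNeg ⊥
    ; unit         =
        let p , q = value-embed 𝟙ᴶ 𝟙≋embed-⊤
        in proj₁ unit ∘ p , q ∘ proj₂ unit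
    ; additive     = value-additive
    }

  μ̂-extends : ∀ b → value (embedᴶ b) ≈ᴿ measure b
  μ̂-extends b = value-embed (embedᴶ b) (id , id)

------------------------------------------------------------------------
-- The Cantor algebra

2^ω : Set
2^ω = ℕ → Bool

infixr 5 _∷ω_

_∷ω_ : Bool → 2^ω → 2^ω
(b ∷ω x) zero    = b
(b ∷ω x) (suc i) = x i

-- By compactness of 2^ω, a subset is clopen iff membership in it depends
-- only on the first n coordinates, for some n.
LocalTo : ℕ → (2^ω → Bool) → Set
LocalTo n χ = ∀ x y → (∀ i → i ℕ.< n → x i ≡ y i) → χ x ≡ χ y

record Clopen : Set where
  field
    χ     : 2^ω → Bool
    depth : ℕ
    local : LocalTo depth χ

open Clopen public

local-mono : ∀ {m n χ} → m ℕ.≤ n → LocalTo m χ → LocalTo n χ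
local-mono m≤n loc x y x≡y = loc x y (λ i i<m → x≡y i (ℕ.<-≤-trans i<m m≤n))

𝔄c : BooleanAlgebra 0ℓ 0ℓ
𝔄c = record
  { Carrier          = Clopen
  ; _≈_              = λ a b → ∀ x → χ a x ≡ χ b x
  ; _∨_              = zip Bool._∨_
  ; _∧_              = zip Bool._∧_
  ; ¬_               = λ a → record
      { χ = Bool.not ∘ χ a ; depth = depth a ; local = λ x y e → cong Bool.not (local a x y e) }
  ; ⊤                = record { χ = const true  ; depth = 0 ; local = λ _ _ _ → refl }
  ; ⊥                = record { χ = const false ; depth = 0 ; local = λ _ _ _ → refl }
  ; isBooleanAlgebra = isBooleanAlgebraʳ (record
    { isDistributiveLattice = isDistributiveLatticeʳʲᵐ (record
      { isLattice    = record
        { isEquivalence = record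
          { refl  = λ _ → refl
          ; sym   = λ p x → sym (p x)
          ; trans = λ p q x → trans (p x) (q x)
          }
        ; ∨-comm     = λ a b x → Bool.∨-comm (χ a x) (χ b x)
        ; ∨-assoc    = λ a b c x → Bool.∨-assoc (χ a x) (χ b x) (χ c x)
        ; ∨-cong     = λ p q x → cong₂ Bool._∨_ (p x) (q x)
        ; ∧-comm     = λ a b x → Bool.∧-comm (χ a x) (χ b x)
        ; ∧-assoc    = λ a b c x → Bool.∧-assoc (χ a x) (χ b x) (χ c x)
        ; ∧-cong     = λ p q x → cong₂ Bool._∧_ (p x) (q x)
        ; absorptive = (λ a b x → Bool.∨-abs-∧ (χ a x) (χ b x))
                     , (λ a b x → Bool.∧-abs-∨ (χ a x) (χ b x))
        }
      ; ∨-distribʳ-∧ = λ a b c x → Bool.∨-distribʳ-∧ (χ a x) (χ b x) (χ c x)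
      })
    ; ∨-complementʳ = λ a x → Bool.∨-inverseʳ (χ a x)
    ; ∧-complementʳ = λ a x → Bool.∧-inverseʳ (χ a x)
    ; ¬-cong        = λ p x → cong Bool.not (p x)
    })
  }
  where
  zip : (Bool → Bool → Bool) → Clopen → Clopen → Clopen
  zip _∙_ a b = record
    { χ     = λ x → χ a x ∙ χ b x
    ; depth = depth a ℕ.⊔ depth b
    ; local = λ x y e → cong₂ _∙_
        (local-mono {χ = χ a} (ℕ.m≤m⊔n (depth a) (depth b)) (local a) x y e)
        (local-mono {χ = χ b} (ℕ.m≤n⊔m (depth a) (depth b)) (local b) x y e)
    }

ℭ : BooleanAlgebra (lsuc 0ℓ) 0ℓ
ℭ = Completion.booleanAlgebra 𝔄c

[_] : ∀ {n} → Vec Bool n → Clopen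
[_] {n} s = record { χ = extends s ; depth = n ; local = extends-local s }
  where
  extends : ∀ {n} → Vec Bool n → 2^ω → Bool
  extends []      x = true
  extends (b ∷ s) x = does (x 0 Bool.≟ b) Bool.∧ extends s (x ∘ suc)

  extends-local : ∀ {n} (s : Vec Bool n) → LocalTo n (extends s)
  extends-local []      x y e = refl
  extends-local (b ∷ s) x y e = cong₂ Bool._∧_
    (cong (λ z → does (z Bool.≟ b)) (e 0 (ℕ.s≤s ℕ.z≤n)))
    (extends-local s (x ∘ suc) (y ∘ suc) (λ i i<n → e (suc i) (ℕ.s≤s i<n)))

------------------------------------------------------------------------
-- Lebesgue measure

-- The proportion of s ∈ 2ⁿ with [ s ] ⊆ {x | χ x ≡ true}, provided that χ
-- depends only on the first n coordinates.
proportion : ℕ → (2^ω → Bool) → ℚ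
proportion zero    χ = if χ (const false) then 1ℚ else 0ℚ
proportion (suc n) χ = ½ ℚ.* (proportion n (χ ∘ (false ∷ω_)) ℚ.+ proportion n (χ ∘ (true ∷ω_)))

∷-local : ∀ {n χ} b → LocalTo (suc n) χ → LocalTo n (χ ∘ (b ∷ω_))
∷-local {n} b loc x y e = loc (b ∷ω x) (b ∷ω y) λ where
  zero    _             → refl
  (suc i) (ℕ.s≤s i<n) → e i i<n

halves : ∀ p → ½ ℚ.* (p ℚ.+ p) ≡ p
halves p = trans (ℚ.*-distribˡ-+ ½ p p) (½p+½p p)

proportion-cong : ∀ n {χ χ′} → (∀ x → χ x ≡ χ′ x) → proportion n χ ≡ proportion n χ′
proportion-cong zero    e = cong (if_then 1ℚ else 0ℚ) (e (const false))
proportion-cong (suc n) e = cong₂ (λ p q → ½ ℚ.* (p ℚ.+ q))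
  (proportion-cong n (e ∘ (false ∷ω_))) (proportion-cong n (e ∘ (true ∷ω_)))

proportion-step : ∀ n χ → LocalTo n χ → proportion n χ ≡ proportion (suc n) χ
proportion-step zero    χ loc = sym (trans
  (cong₂ (λ p q → ½ ℚ.* (p ℚ.+ q)) (same false) (same true))
  (halves (proportion 0 χ)))
  where
  same : ∀ b → proportion 0 (χ ∘ (b ∷ω_)) ≡ proportion 0 χ
  same b = cong (if_then 1ℚ else 0ℚ) (loc (b ∷ω const false) (const false) (λ _ ()))
proportion-step (suc n) χ loc = cong₂ (λ p q → ½ ℚ.* (p ℚ.+ q))
  (proportion-step n (χ ∘ (false ∷ω_)) (∷-local {χ = χ} false loc))
  (proportion-step n (χ ∘ (true ∷ω_)) (∷-local {χ = χ} true loc))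

proportion-+ : ∀ k {n} χ → LocalTo n χ → proportion n χ ≡ proportion (k ℕ.+ n) χ
proportion-+ zero    χ loc = refl
proportion-+ (suc k) {n} χ loc = trans (proportion-+ k χ loc)
  (proportion-step (k ℕ.+ n) χ (local-mono {χ = χ} (ℕ.m≤n+m n k) loc))

proportion-≤ : ∀ {m n} χ → LocalTo m χ → m ℕ.≤ n → proportion m χ ≡ proportion n χ
proportion-≤ {m} {n} χ loc m≤n =
  trans (proportion-+ (n ℕ.∸ m) χ loc) (cong (λ k → proportion k χ) (ℕ.m∸n+n≡m m≤n))

proportion-additive : ∀ n χ χ′ → (∀ x → χ x Bool.∧ χ′ x ≡ false) →
  proportion n (λ x → χ x Bool.∨ χ′ x) ≡ proportion n χ ℚ.+ proportion n χ′
proportion-additive zero χ χ′ d with χ (const false) | χ′ (const false) | d (const false)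
... | true  | true  | ()
... | true  | false | _ = refl
... | false | true  | _ = refl
... | false | false | _ = refl
proportion-additive (suc n) χ χ′ d = trans
  (cong₂ (λ p q → ½ ℚ.* (p ℚ.+ q))
    (proportion-additive n (χ ∘ (false ∷ω_)) (χ′ ∘ (false ∷ω_)) (d ∘ (false ∷ω_)))
    (proportion-additive n (χ ∘ (true ∷ω_)) (χ′ ∘ (true ∷ω_)) (d ∘ (true ∷ω_))))
  (rearrange ½ (proportion n (χ ∘ (false ∷ω_))) (proportion n (χ′ ∘ (false ∷ω_)))
               (proportion n (χ ∘ (true ∷ω_))) (proportion n (χ′ ∘ (true ∷ω_))))
  where
  open +-*-Solver
  rearrange : ∀ h p p′ q q′ → h ℚ.* ((p ℚ.+ p′) ℚ.+ (q ℚ.+ q′)) ≡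
                              h ℚ.* (p ℚ.+ q) ℚ.+ h ℚ.* (p′ ℚ.+ q′)
  rearrange = solve 5 (λ h p p′ q q′ →
    h :* ((p :+ p′) :+ (q :+ q′)) := h :* (p :+ q) :+ h :* (p′ :+ q′)) refl

proportion-nonNeg : ∀ n χ → 0ℚ ℚ.≤ proportion n χ
proportion-nonNeg zero χ with χ (const false)
... | true  = ℚ.nonNegative⁻¹ 1ℚ
... | false = ℚ.≤-refl
proportion-nonNeg (suc n) χ = ℚ.*-monoˡ-≤-nonNeg ½
  (ℚ.+-mono-≤ (proportion-nonNeg n (χ ∘ (false ∷ω_))) (proportion-nonNeg n (χ ∘ (true ∷ω_))))

fromℚ-cong : ∀ {p q} → p ≡ q → fromℚ p ≈ᴿ fromℚ q
fromℚ-cong refl = id , id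

fromℚ-+ : ∀ p q → fromℚ (p ℚ.+ q) ≈ᴿ fromℚ p +ᴿ fromℚ q
fromℚ-+ p q =
  (λ {r} r<p+q →
    let d = ½ ℚ.* ((p ℚ.+ q) ℚ.- r)
        0<d = 0<½p (p<q⇒0<q-p r<p+q)
    in p ℚ.- d , q ℚ.- d , p-d<p p d 0<d , p-d<p q d 0<d ,
       trans (lem₁ p q d) (trans (cong (λ z → (p ℚ.+ q) ℚ.- z) (½p+½p ((p ℚ.+ q) ℚ.- r)))
                                 (lem₂ (p ℚ.+ q) r))) ,
  (λ { (p′ , q′ , p′<p , q′<q , refl) → ℚ.+-mono-< p′<p q′<q })
  where
  open +-*-Solver
  p-d<p : ∀ p d → 0ℚ ℚ.< d → p ℚ.- d ℚ.< p
  p-d<p p d 0<d = subst (p ℚ.- d ℚ.<_) ([q-p]+p d p) (p<p+d (p ℚ.- d) 0<d)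
  lem₁ : ∀ p q d → (p ℚ.- d) ℚ.+ (q ℚ.- d) ≡ (p ℚ.+ q) ℚ.- (d ℚ.+ d)
  lem₁ = solve 3 (λ p q d → (p :- d) :+ (q :- d) := (p :+ q) :- (d :+ d)) refl
  lem₂ : ∀ s r → s ℚ.- (s ℚ.- r) ≡ r
  lem₂ = solve 2 (λ s r → s :- (s :- r) := r) refl

lebesgue : Measure 𝔄c
lebesgue = record
  { measure      = λ a → fromℚ (vol a)
  ; measure-cong = λ {a} {b} a≈b →
      let n = depth a ℕ.⊔ depth b
      in fromℚ-cong (trans (vol-at a (ℕ.m≤m⊔n (depth a) (depth b)))
           (trans (proportion-cong n a≈b) (sym (vol-at b (ℕ.m≤n⊔m (depth a) (depth b))))))
  ; nonNeg       = λ a q<0 → ℚ.<-≤-trans q<0 (proportion-nonNeg (depth a) (χ a))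
  ; unit         = id , id
  ; additive     = λ a b d →
      let n = depth a ℕ.⊔ depth b
          e = trans (proportion-additive n (χ a) (χ b) d)
                (sym (cong₂ ℚ._+_ (vol-at a (ℕ.m≤m⊔n (depth a) (depth b)))
                                  (vol-at b (ℕ.m≤n⊔m (depth a) (depth b)))))
          p , q = fromℚ-cong e
          r , s = fromℚ-+ (vol a) (vol b)
      in r ∘ p , q ∘ s
  }
  where
  vol : Clopen → ℚ
  vol a = proportion (depth a) (χ a)
  vol-at : ∀ a {n} → depth a ℕ.≤ n → vol a ≡ proportion n (χ a)
  vol-at a = proportion-≤ (χ a) (local a)

½^_ : ℕ → ℚ
½^ zero  = 1ℚ
½^ suc n = ½ ℚ.* ½^ n

lebesgue-cylinder : ∀ {n} (s : Vec Bool n) → Measure.measure lebesgue [ s ] ≈ᴿ fromℚ (½^ n)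
lebesgue-cylinder s = fromℚ-cong (go s)
  where
  null : ∀ n → proportion n (const false) ≡ 0ℚ
  null zero    = refl
  null (suc n) = cong₂ (λ p q → ½ ℚ.* (p ℚ.+ q)) (null n) (null n)
  go : ∀ {n} (s : Vec Bool n) → proportion n (χ [ s ]) ≡ ½^ n
  go []                  = refl
  go (_∷_ {n} false s) = cong (½ ℚ.*_) (trans (cong₂ ℚ._+_ (go s) (null n)) (ℚ.+-identityʳ (½^ n)))
  go (_∷_ {n} true s)  = cong (½ ℚ.*_) (trans (cong₂ ℚ._+_ (null n) (go s)) (ℚ.+-identityˡ (½^ n)))

{-# OPTIONS --safe #-}

-- Order the cylinders of each depth lexicographically.  Cumulative measure
-- turns a depth-n cylinder into an interval of [0,1], for μ as well as for
-- Lebesgue measure, and two clopen sets are "apart" when, at some depth, no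
-- μ-interval of the first overlaps a Lebesgue interval of the second.
-- Strict positivity makes every interval nondegenerate, so that clopen sets
-- apart from the two members of a cover are disjoint; non-atomicity makes the
-- intervals short, so that every clopen set can be approximated in measure,
-- from inside and outside, by clopen sets of the other algebra.  These two
-- facts alone suffice: sending a regular ideal I to the regular closure of
-- {b | b is apart from ∁ a for some a ∈ I} is then an order isomorphism of the
-- completions, with inverse the same construction in the other direction,
-- and it maps Jordan elements to Jordan elements of the same measure.

module Submission where

open import Defs

open import Algebra.Lattice using (BooleanAlgebra)
import Algebra.Lattice.Properties.BooleanAlgebra as BooleanProperties
open import Data.Bool.Base as Bool using (Bool; true; false; if_then_else_)
import Data.Bool.Properties as Bool
open import Data.Empty using (⊥-elim) renaming (⊥ to Empty)
open import Data.Integer.Base as ℤ using (+_; +[1+_])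
open import Data.List.Base using (List; []; _∷_; foldr)
open import Data.List.Relation.Unary.All using (All; []; _∷_)
open import Data.Nat.Base as ℕ using (ℕ; zero; suc; ≤′-refl; ≤′-step)
import Data.Nat.Properties as ℕ
open import Data.Nat.DivMod using (m≡m%n+[m/n]*n; m%n<n; m<n*o⇒m/o<n)
open import Data.Product.Base using (∃; _×_; _,_; proj₁; proj₂; swap)
open import Data.Rational as ℚ using (ℚ; 0ℚ; 1ℚ; ½; toℚᵘ)
import Data.Rational.Properties as ℚ
open import Data.Rational.Solver using (module +-*-Solver)
open import Data.Rational.Unnormalised.Base as ℚᵘ using (mkℚᵘ)
import Data.Rational.Unnormalised.Properties as ℚᵘ
open import Data.Sum.Base using (_⊎_; inj₁; inj₂; [_,_]′)
open import Data.Vec.Base using (Vec; []; _∷_)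
open import Function.Base using (id; _∘_; const; flip)
open import Level using (0ℓ)
import Relation.Binary.Lattice as Order
open import Relation.Binary.Definitions using (tri<; tri≈; tri>)
open import Relation.Binary.PropositionalEquality
  using (_≡_; _≢_; refl; sym; trans; cong; cong₂; subst; subst₂)
open import Relation.Nullary.Decidable using (Dec; yes; no; does; dec-true; dec-false)
open import Relation.Nullary.Negation using (¬_)
open import Relation.Unary using (Pred; _∈_; _⊆_)

open Measure using (measure; measure-cong; nonNeg; unit; additive)

-- Transport along a separation

module BooleanLemmas (B : BooleanAlgebra 0ℓ 0ℓ) where
  open BooleanAlgebra B hiding (refl; sym; trans) renaming (¬_ to ∁_)
  open BooleanAlgebra B using () renaming (sym to ≈-sym; trans to ≈-trans)
  open BooleanProperties B
  open Completion B
  open import Relation.Binary.Reasoning.Setoid setoid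

  disjoint-∁⇒≤ : ∀ {x y} → x ∧ ∁ y ≈ ⊥ → x ≤ y
  disjoint-∁⇒≤ {x} {y} d = begin
    x                    ≈⟨ ∧-identityʳ x ⟨
    x ∧ ⊤                ≈⟨ ∧-congˡ (∨-complementʳ y) ⟨
    x ∧ (y ∨ ∁ y)        ≈⟨ ∧-distribˡ-∨ x y (∁ y) ⟩
    (x ∧ y) ∨ (x ∧ ∁ y)  ≈⟨ ∨-congˡ d ⟩
    (x ∧ y) ∨ ⊥          ≈⟨ ∨-identityʳ (x ∧ y) ⟩
    x ∧ y                ∎

  disjoint⇒∁-cover : ∀ {x y} → x ∧ y ≈ ⊥ → ∁ x ∨ ∁ y ≈ ⊤
  disjoint⇒∁-cover {x} {y} d = begin
    ∁ x ∨ ∁ y  ≈⟨ deMorgan₁ x y ⟨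
    ∁ (x ∧ y)  ≈⟨ ¬-cong d ⟩
    ∁ ⊥        ≈⟨ ¬⊥≈⊤ ⟩
    ⊤          ∎

  ≤⇒∁-cover : ∀ {x y} → x ≤ y → ∁ x ∨ y ≈ ⊤
  ≤⇒∁-cover {x} {y} x≤y = begin
    ∁ x ∨ y          ≈⟨ ∨-congʳ (¬-cong x≤y) ⟩
    ∁ (x ∧ y) ∨ y    ≈⟨ ∨-congʳ (deMorgan₁ x y) ⟩
    (∁ x ∨ ∁ y) ∨ y  ≈⟨ ∨-assoc (∁ x) (∁ y) y ⟩
    ∁ x ∨ (∁ y ∨ y)  ≈⟨ ∨-congˡ (∨-complementˡ y) ⟩
    ∁ x ∨ ⊤          ≈⟨ ∨-zeroʳ (∁ x) ⟩
    ⊤                ∎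

  ≤-refl : ∀ {x} → x ≤ x
  ≤-refl {x} = ≈-sym (∧-idem x)

  x∧y≤x : ∀ x y → x ∧ y ≤ x
  x∧y≤x = Order.Lattice.x∧y≤x ∨-∧-orderTheoreticLattice

  x∧y≤y : ∀ x y → x ∧ y ≤ y
  x∧y≤y = Order.Lattice.x∧y≤y ∨-∧-orderTheoreticLattice

  disjoint-∧ : ∀ {x y} z → x ∧ y ≈ ⊥ → x ∧ (y ∧ z) ≈ ⊥
  disjoint-∧ {x} {y} z d = begin
    x ∧ (y ∧ z)  ≈⟨ ∧-assoc x y z ⟨
    (x ∧ y) ∧ z  ≈⟨ ∧-congʳ d ⟩
    ⊥ ∧ z        ≈⟨ ∧-zeroˡ z ⟩
    ⊥            ∎

  ⊥⊥-least : ∀ P J → P ⊆ ideal J → polar (P ⊥ᵖ) ⊑ J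
  ⊥⊥-least P J P⊆J x∈ = regular J (antitone (antitone P⊆J) x∈)

module _ {B : BooleanAlgebra 0ℓ 0ℓ} (μ : Measure B) where
  open BooleanAlgebra B hiding (refl; sym; trans) renaming (¬_ to ∁_)
  open BooleanAlgebra B using () renaming (trans to ≈-trans)
  open BooleanProperties B

  L-bounded : ∀ a {p} → p ∈ L (measure μ a) → p ℚ.< 1ℚ
  L-bounded a = proj₁ (unit μ) ∘ monotone μ (BooleanAlgebra.sym B (∧-identityʳ a))

  U-bounded : ∀ a {p} → p ∈ U (measure μ a) → 0ℚ ℚ.≤ p
  U-bounded a p∈ = ℚ.≮⇒≥ λ p<0 →
    ℚ.<-irrefl refl (ℝ.disjoint (measure μ a) (nonNeg μ a p<0) p∈)

  total : ∀ a → measure μ a +ᴿ measure μ (∁ a) ≈ᴿ 1ᴿ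
  total a =
    let p , q = additive μ a (∁ a) (∧-complementʳ a)
        r , s = measure-cong μ (∨-complementʳ a)
    in proj₁ (unit μ) ∘ r ∘ q , p ∘ s ∘ proj₂ (unit μ)

  -- A null `a` is disjoint from itself, so its measure m satisfies m + m = m; a positive `q` below
  -- m would then also lie above m.
  L-null : ∀ a → a ≈ ⊥ → ∀ {p} → p ∈ L (measure μ a) → p ℚ.< 0ℚ
  L-null a a≈⊥ {p} p∈ =
    let q , p<q , q∈ = ℝ.L-open (measure μ a) p∈
    in ℚ.<-≤-trans p<q (ℚ.≮⇒≥ λ 0<q →
         let s , s∈ , s+∈ = ℝ.tight (measure μ a) 0<q
         in ℚ.<-irrefl refl (ℝ.disjoint (measure μ a) q∈
              (difference (measure μ a) (measure μ a) (measure μ a)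
                (proj₁ (measure-cong μ (∨-idem a)) ∘
                 proj₂ (additive μ a a (≈-trans (∧-idem a) a≈⊥))) s∈ s+∈)))

  L-inhabited : ∀ a → 0ℚ ∈ L (measure μ a) → ¬ a ≈ ⊥
  L-inhabited a 0∈ a≈⊥ = ℚ.<-irrefl refl (L-null a a≈⊥ 0∈)

-- a ⟂ b is to be read as disjointness of a and b inside a common extension
-- of the two measured algebras; only the laws from A to B are listed, the
-- others being those of flip _⟂_.
record Separation {A B : BooleanAlgebra 0ℓ 0ℓ} (μ : Measure A) (ν : Measure B)
  (_⟂_ : BooleanAlgebra.Carrier A → BooleanAlgebra.Carrier B → Set) : Set where
  private
    module A = BooleanAlgebra A
    module B = BooleanAlgebra B
  field
    cover        : ∀ {a a′ b b′} → a ⟂ b → a′ ⟂ b′ → a A.∨ a′ A.≈ A.⊤ → b B.∧ b′ B.≈ B.⊥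
    inscribe     : ∀ a {p} → p ∈ L (measure μ a) →
                   ∃ λ b → (A.¬ a) ⟂ b × p ∈ L (measure ν b)
    circumscribe : ∀ a {q} → q ∈ U (measure μ a) →
                   ∃ λ b → a ⟂ (B.¬ b) × q ∈ U (measure ν b)
    stable       : ∀ b → ¬ ¬ (b B.≈ B.⊥) → b B.≈ B.⊥
    positive     : StrictlyPositive ν

  0∈L : ∀ b → ¬ b B.≈ B.⊥ → 0ℚ ∈ L (measure ν b)
  0∈L b b≉⊥ = let q , 0<q , q∈ = positive b b≉⊥ in ℝ.L-lower (measure ν b) 0<q q∈

module Transport {A B : BooleanAlgebra 0ℓ 0ℓ} {μ : Measure A} {ν : Measure B}
  {_⟂_ : BooleanAlgebra.Carrier A → BooleanAlgebra.Carrier B → Set}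
  (separation : Separation μ ν _⟂_) where

  open Separation separation
  private
    module A = BooleanAlgebra A
    module B = BooleanAlgebra B
    module Aℭ = Completion A
    module Bℭ = Completion B
    module A′ = BooleanLemmas A
    module B′ = BooleanLemmas B
  open Completion using (ideal)

  -- Read `(A.¬ a) ⟂ b` as "b lies under a" and `a ⟂ (B.¬ b)` as "a lies under b".
  Image : Aℭ.RegularIdeal → Pred B.Carrier 0ℓ
  Image I b = ∃ λ a → a ∈ ideal I × (A.¬ a) ⟂ b

  transport : Aℭ.RegularIdeal → Bℭ.RegularIdeal
  transport I = Bℭ.polar (Image I Bℭ.⊥ᵖ)

  Image⊆transport : ∀ I → Image I ⊆ ideal (transport I)
  Image⊆transport I = Bℭ.P⊆P⊥⊥ (Image I)

  transport-mono : ∀ I J → I Aℭ.⊑ J → transport I Bℭ.⊑ transport J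
  transport-mono I J I⊑J =
    Bℭ.antitone (Bℭ.antitone λ (a , a∈I , a⟂b) → a , I⊑J a∈I , a⟂b)

  -- Each member of `Image I` lies under some `a′ ≤ a`. Since the complement of `a′` together with
  -- `a` covers the unit, `cover` makes that member disjoint from the complement of `b`.
  transport-⊑ : ∀ I {a b} → I Aℭ.⊑ Aℭ.embed a → a ⟂ (B.¬ b) → transport I Bℭ.⊑ Bℭ.embed b
  transport-⊑ I {a} {b} I⊑a a⟂∁b = B′.⊥⊥-least (Image I) (Bℭ.embed b)
    λ (a′ , a′∈I , ∁a′⟂b′) →
      B′.disjoint-∁⇒≤ (cover ∁a′⟂b′ a⟂∁b (A′.≤⇒∁-cover (I⊑a a′∈I)))

  transportᴶ : Jordan μ → Jordan ν
  transportᴶ J = record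
    { element = transport I
    ; value   = v
    ; inner   =
        -- Every rational above `v` bounds the measure of some outer `c`, and an inner `b` lies
        -- below each such `c`.
        (λ (b , b⊑I) → U⊇⇒≤ᴿ (measure ν b) v λ q∈ →
          let c , I⊑c , q∈c = outside q∈
          in ≤ᴿ⇒U⊇ (measure ν b) (measure ν c) (monotone ν (Bℭ.embed-cancel (I⊑c ∘ b⊑I))) q∈c) ,
        (λ (q , q∈U , q∈L) → let b , b⊑I , q∈b = inside q∈L in (b , b⊑I) , q , q∈U , q∈b)
    ; outer   =
        (λ (c , I⊑c) p∈ →
          let b , b⊑I , p∈b = inside p∈
          in monotone ν (Bℭ.embed-cancel (I⊑c ∘ b⊑I)) p∈b) ,
        (λ (q , q∈U , q∈L) → let c , I⊑c , q∈c = outside q∈U in (c , I⊑c) , q , q∈c , q∈L)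
    }
    where
    I = element J
    v = value J

    inside : ∀ {p} → p ∈ L v → ∃ λ b → Bℭ.embed b Bℭ.⊑ transport I × p ∈ L (measure ν b)
    inside p∈ =
      let a , a⊑I , p∈a = inner-approx μ J p∈
          b , ∁a⟂b , p∈b = inscribe a p∈a
          b∈ = Image⊆transport I (a , a⊑I A′.≤-refl , ∁a⟂b)
      in b , (λ x≤b → Bℭ.lower (transport I) x≤b b∈) , p∈b

    outside : ∀ {q} → q ∈ U v → ∃ λ c → transport I Bℭ.⊑ Bℭ.embed c × q ∈ U (measure ν c)
    outside q∈ =
      let a , I⊑a , q∈a = outer-approx μ J q∈
          c , a⟂∁c , q∈c = circumscribe a q∈a
      in c , transport-⊑ I I⊑a a⟂∁c , q∈c

-- The two transports are mutually inverse

module Inverse {A B : BooleanAlgebra 0ℓ 0ℓ} {μ : Measure A} {ν : Measure B}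
  {_⟂_ : BooleanAlgebra.Carrier A → BooleanAlgebra.Carrier B → Set}
  (μ→ν : Separation μ ν _⟂_) (ν→μ : Separation ν μ (flip _⟂_)) where

  private
    module A = BooleanAlgebra A
    module B = BooleanAlgebra B
    module Aℭ = Completion A
    module Bℭ = Completion B
    module A′ = BooleanLemmas A
    module B′ = BooleanLemmas B
    module fwd = Separation μ→ν
    module bwd = Separation ν→μ
    module Φ = Transport μ→ν
    module Ψ = Transport ν→μ
  open Completion using (ideal; regular)

  private
    -- A nonzero `a` has positive measure, so some `b` of positive measure can be inscribed under
    -- it. Hence it is enough to refute nonzero elements under `a`.
    ≈⊥-by-probe : ∀ a → (∀ b → (A.¬ a) ⟂ b → ¬ ¬ (b B.≈ B.⊥)) → a A.≈ A.⊥
    ≈⊥-by-probe a h = bwd.stable a λ a≉⊥ →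
      let b , ∁a⟂b , 0∈b = fwd.inscribe a (bwd.0∈L a a≉⊥)
      in h b ∁a⟂b (L-inhabited ν b 0∈b)

  Ψ∘Φ-⊑ : ∀ I → Ψ.transport (Φ.transport I) Aℭ.⊑ I
  Ψ∘Φ-⊑ I = A′.⊥⊥-least (Ψ.Image (Φ.transport I)) I λ {a} (b , b∈Φ , a⟂∁b) →
    regular I λ {a′} a′∈I⊥ → ≈⊥-by-probe (a′ A.∧ a) λ b′ ∁c⟂b′ b′≉⊥ →
      -- The probe `b′` lies under an element disjoint from all of `I`, so it misses the whole image
      -- of `I`, and therefore `b`. It also lies under `a`, which lies under `b`, so it must vanish.
      let b′∧b≈⊥ = b∈Φ λ (a″ , a″∈I , ∁a″⟂b″) → fwd.cover ∁a″⟂b″ ∁c⟂b′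
            (A′.disjoint⇒∁-cover (A′.disjoint-∧ a (a′∈I⊥ a″∈I)))
          b′∧∁b≈⊥ = fwd.cover ∁c⟂b′ a⟂∁b (A′.≤⇒∁-cover (A′.x∧y≤y a′ a))
      in b′≉⊥ (B.trans (B′.disjoint-∁⇒≤ b′∧∁b≈⊥) b′∧b≈⊥)

  ⊑-Ψ∘Φ : ∀ I → I Aℭ.⊑ Ψ.transport (Φ.transport I)
  ⊑-Ψ∘Φ I {a} a∈I {a′} a′∈ = ≈⊥-by-probe (a′ A.∧ a) λ b ∁c⟂b b≉⊥ →
    let b∈Φ = Φ.Image⊆transport I (_ , Aℭ.lower I (A′.x∧y≤y a′ a) a∈I , ∁c⟂b)
        -- Inscribing back under the probe gives a nonzero `a″` in the image of `Φ.transport I`,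
        -- hence disjoint from `a′`, although `cover` puts it below `a′ ∧ a`.
        a″ , a″⟂∁b , 0∈a″ = bwd.inscribe b (fwd.0∈L b b≉⊥)
        a″≤c = A′.disjoint-∁⇒≤ (bwd.cover a″⟂∁b ∁c⟂b (B.∨-complementˡ b))
    in L-inhabited μ a″ 0∈a″ (A.trans a″≤c (A′.disjoint-∧ a (a′∈ (b , b∈Φ , a″⟂∁b))))

-- Preservation of the Boolean operations

module Homomorphism {A B : BooleanAlgebra 0ℓ 0ℓ} {μ : Measure A} {ν : Measure B}
  {_⟂_ : BooleanAlgebra.Carrier A → BooleanAlgebra.Carrier B → Set}
  (μ→ν : Separation μ ν _⟂_) (ν→μ : Separation ν μ (flip _⟂_)) where

  private
    module A = BooleanAlgebra A
    module Aℭ = Completion A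
    module A′ = BooleanLemmas A
    module B′ = BooleanLemmas B
    module Bℭ = Completion B
    module Φ = Transport μ→ν
    module Ψ = Transport ν→μ
  open Inverse μ→ν ν→μ
  open Inverse ν→μ μ→ν renaming (Ψ∘Φ-⊑ to Φ∘Ψ-⊑; ⊑-Ψ∘Φ to ⊑-Φ∘Ψ)

  -- Mutually inverse monotone maps are adjoint on both sides: as a right adjoint `Φ.transport`
  -- preserves meets, as a left adjoint (`Φ-coadjoint`) joins.
  Φ-adjoint : ∀ K I → Ψ.transport K Aℭ.⊑ I → K Bℭ.⊑ Φ.transport I
  Φ-adjoint K I ΨK⊑I = Φ.transport-mono (Ψ.transport K) I ΨK⊑I ∘ ⊑-Φ∘Ψ K

  Ψ-adjoint : ∀ K I → K Bℭ.⊑ Φ.transport I → Ψ.transport K Aℭ.⊑ I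
  Ψ-adjoint K I K⊑ΦI = Ψ∘Φ-⊑ I ∘ Ψ.transport-mono K (Φ.transport I) K⊑ΦI

  Φ-coadjoint : ∀ I K → I Aℭ.⊑ Ψ.transport K → Φ.transport I Bℭ.⊑ K
  Φ-coadjoint I K I⊑ΨK = Φ∘Ψ-⊑ K ∘ Φ.transport-mono I (Ψ.transport K) I⊑ΨK

  transport-⊓ : ∀ I J → Φ.transport (I Aℭ.⊓ J) Bℭ.≋ Φ.transport I Bℭ.⊓ Φ.transport J
  transport-⊓ I J =
    (λ b∈ → Φ.transport-mono (I Aℭ.⊓ J) I proj₁ b∈ , Φ.transport-mono (I Aℭ.⊓ J) J proj₂ b∈) ,
    Φ-adjoint K (I Aℭ.⊓ J) (λ a∈ → Ψ-adjoint K I proj₁ a∈ , Ψ-adjoint K J proj₂ a∈)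
    where
    K = Φ.transport I Bℭ.⊓ Φ.transport J

  transport-⊔ : ∀ I J → Φ.transport (I Aℭ.⊔ J) Bℭ.≋ Φ.transport I Bℭ.⊔ Φ.transport J
  transport-⊔ I J =
    Φ-coadjoint (I Aℭ.⊔ J) K (Aℭ.⊔-least I J (Ψ.transport K)
      (Ψ.transport-mono (Φ.transport I) K (Bℭ.⊔-upperˡ (Φ.transport I) (Φ.transport J)) ∘ ⊑-Ψ∘Φ I)
      (Ψ.transport-mono (Φ.transport J) K (Bℭ.⊔-upperʳ (Φ.transport I) (Φ.transport J)) ∘ ⊑-Ψ∘Φ J)) ,
    Bℭ.⊔-least (Φ.transport I) (Φ.transport J) (Φ.transport (I Aℭ.⊔ J))
      (Φ.transport-mono I (I Aℭ.⊔ J) (Aℭ.⊔-upperˡ I J))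
      (Φ.transport-mono J (I Aℭ.⊔ J) (Aℭ.⊔-upperʳ I J))
    where
    K = Φ.transport I Bℭ.⊔ Φ.transport J

  transport-𝟙 : Φ.transport Aℭ.𝟙 Bℭ.≋ Bℭ.𝟙
  transport-𝟙 = _ , Φ-adjoint Bℭ.𝟙 Aℭ.𝟙 _

  transport-𝟘 : Φ.transport Aℭ.𝟘 Bℭ.≋ Bℭ.𝟘
  transport-𝟘 = Φ-coadjoint Aℭ.𝟘 Bℭ.𝟘 (Aℭ.𝟘-least (Ψ.transport Bℭ.𝟘)) ,
                Bℭ.𝟘-least (Φ.transport Aℭ.𝟘)

  transport-injective : ∀ I J → Φ.transport I Bℭ.≋ Φ.transport J → I Aℭ.≋ J
  transport-injective I J (p , q) = Ψ-adjoint (Φ.transport I) J p ∘ ⊑-Ψ∘Φ I ,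
                                  Ψ-adjoint (Φ.transport J) I q ∘ ⊑-Ψ∘Φ J

  transport-disjoint : ∀ I → Φ.transport (Aℭ.~ I) Bℭ.⊑ Bℭ.~ Φ.transport I
  transport-disjoint I {b} b∈ {b′} b′∈ = proj₁ transport-𝟘
      (Φ.transport-mono (Aℭ.~ I Aℭ.⊓ I) Aℭ.𝟘
        (λ (a∈~I , a∈I) → A.trans A′.≤-refl (a∈~I a∈I))
        (proj₂ (transport-⊓ (Aℭ.~ I) I)
          ( Bℭ.lower (Φ.transport (Aℭ.~ I)) (B′.x∧y≤y b′ b) b∈
          , Bℭ.lower (Φ.transport I) (B′.x∧y≤x b′ b) b′∈)))

module Isomorphism {A B : BooleanAlgebra 0ℓ 0ℓ} {μ : Measure A} {ν : Measure B}
  {_⟂_ : BooleanAlgebra.Carrier A → BooleanAlgebra.Carrier B → Set}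
  (μ→ν : Separation μ ν _⟂_) (ν→μ : Separation ν μ (flip _⟂_)) where


  private
    module Aℭ = Completion A
    module Bℭ = Completion B
    module Φ = Transport μ→ν
    module Ψ = Transport ν→μ
    module Converse = Homomorphism ν→μ μ→ν
  open Homomorphism μ→ν ν→μ
  open Inverse μ→ν ν→μ

  -- Disjointness is preserved in both directions; applying this to the inverse transport and moving
  -- the result across the adjunction gives the reverse inclusion.
  transport-~ : ∀ I → Φ.transport (Aℭ.~ I) Bℭ.≋ Bℭ.~ Φ.transport I
  transport-~ I = transport-disjoint I ,
    Φ-adjoint (Bℭ.~ Φ.transport I) (Aℭ.~ I)
      (Aℭ.antitone (⊑-Ψ∘Φ I) ∘ Converse.transport-disjoint (Φ.transport I))

  metricIsomorphism : MetricIsomorphism (𝒥 μ) (μ̂ μ) (𝒥 ν) (μ̂ ν)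
  metricIsomorphism = record
    { to                   = Φ.transportᴶ
    ; isLatticeIsomorphism = record
      { isLatticeMonomorphism = record
        { isLatticeHomomorphism = record
          { isRelHomomorphism = record
            { cong = λ {J} {K} (p , q) →
                Φ.transport-mono (element J) (element K) p ,
                Φ.transport-mono (element K) (element J) q
            }
          ; ∧-homo = λ J K → transport-⊓ (element J) (element K)
          ; ∨-homo = λ J K → transport-⊔ (element J) (element K)
          }
        ; injective = λ {J} {K} → transport-injective (element J) (element K)
        }
      ; surjective = λ K → Ψ.transportᴶ K , λ {J} (p , q) →
          Φ-coadjoint (element J) (element K) p ,
          Φ-adjoint (element K) (element J) q
      }
    ; ⊤-homo             = transport-𝟙
    ; ⊥-homo             = transport-𝟘
    ; ¬-homo             = λ J → transport-~ (element J)
    ; measure-preserving = λ J → id , id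
    }

-- Clopen sets and cylinders

open Completion 𝔄c using (_≤_)
open BooleanAlgebra 𝔄c using (_≈_; _∧_; _∨_; ⊤; ⊥) renaming (¬_ to ∁_)

does-true : ∀ {A : Set} (A? : Dec A) → does A? ≡ true → A
does-true (yes a) _ = a

-- Tightness with error `q - p` yields a lower bound `t`: either `p` is at most `t`, or
-- `t + (q - p)` is an upper bound below `q`.
locate : ∀ x {p q} → p ℚ.< q → p ∈ L x ⊎ q ∈ U x
locate x {p} {q} p<q with ℝ.tight x (p<q⇒0<q-p p<q)
... | t , t∈ , t+∈ with ℚ.<-cmp p t
... | tri< p<t _ _ = inj₁ (ℝ.L-lower x p<t t∈)
... | tri≈ _ refl _ = inj₁ t∈
... | tri> _ _ t<p = inj₂ (ℝ.U-upper x
  (subst (t ℚ.+ (q ℚ.- p) ℚ.<_) (p+[q-p] p q) (ℚ.+-monoˡ-< (q ℚ.- p) t<p)) t+∈)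

infix 4 _∈ᶜ_

_∈ᶜ_ : 2^ω → Clopen → Set
x ∈ᶜ a = χ a x ≡ true

∈ᶜ-cases : ∀ a x → x ∈ᶜ a ⊎ x ∈ᶜ ∁ a
∈ᶜ-cases a x with χ a x
... | true  = inj₁ refl
... | false = inj₂ refl

∈ᶜ-∁ : ∀ a {x} → x ∈ᶜ ∁ a → ¬ x ∈ᶜ a
∈ᶜ-∁ a {x} x∈∁a x∈a with χ a x
∈ᶜ-∁ a {x} () x∈a | true
∈ᶜ-∁ a {x} x∈∁a () | false

∉ᶜ⇒∈ᶜ-∁ : ∀ a {x} → ¬ x ∈ᶜ a → x ∈ᶜ ∁ a
∉ᶜ⇒∈ᶜ-∁ a {x} x∉a = [ ⊥-elim ∘ x∉a , id ]′ (∈ᶜ-cases a x)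

∈ᶜ-∧⁺ : ∀ a b {x} → x ∈ᶜ a → x ∈ᶜ b → x ∈ᶜ a ∧ b
∈ᶜ-∧⁺ a b = cong₂ Bool._∧_

∈ᶜ-∧⁻ : ∀ a b {x} → x ∈ᶜ a ∧ b → x ∈ᶜ a × x ∈ᶜ b
∈ᶜ-∧⁻ a b {x} e with χ a x | χ b x
∈ᶜ-∧⁻ a b e | true | true = refl , refl
∈ᶜ-∧⁻ a b () | true | false
∈ᶜ-∧⁻ a b () | false | _

∈ᶜ-∨⁺ : ∀ a b {x} → x ∈ᶜ a ⊎ x ∈ᶜ b → x ∈ᶜ a ∨ b
∈ᶜ-∨⁺ a b {x} (inj₁ x∈a) = cong (Bool._∨ χ b x) x∈a
∈ᶜ-∨⁺ a b {x} (inj₂ x∈b) = trans (cong (χ a x Bool.∨_) x∈b) (Bool.∨-zeroʳ (χ a x))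

∈ᶜ-∨⁻ : ∀ a b {x} → x ∈ᶜ a ∨ b → x ∈ᶜ a ⊎ x ∈ᶜ b
∈ᶜ-∨⁻ a b {x} e with χ a x
... | true  = inj₁ refl
... | false = inj₂ e

≤⁺ : ∀ a b → (∀ {x} → x ∈ᶜ a → x ∈ᶜ b) → a ≤ b
≤⁺ a b h x with χ a x in e
... | true  = sym (h e)
... | false = refl

disjoint⁺ : ∀ a b → (∀ {x} → x ∈ᶜ a → x ∈ᶜ b → Empty) → a ∧ b ≈ ⊥
disjoint⁺ a b h x with χ (a ∧ b) x in e
... | true  = let x∈a , x∈b = ∈ᶜ-∧⁻ a b e in ⊥-elim (h x∈a x∈b)
... | false = refl

disjoint⁻ : ∀ a b → a ∧ b ≈ ⊥ → ∀ {x} → x ∈ᶜ a → x ∈ᶜ b → Empty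
disjoint⁻ a b d {x} x∈a x∈b with trans (sym (d x)) (∈ᶜ-∧⁺ a b x∈a x∈b)
... | ()

≈⊥⁺ : ∀ a → (∀ {x} → x ∈ᶜ a → Empty) → a ≈ ⊥
≈⊥⁺ a h x with χ a x in e
... | true  = ⊥-elim (h e)
... | false = refl

≈⊥⁻ : ∀ a → a ≈ ⊥ → ∀ {x} → ¬ x ∈ᶜ a
≈⊥⁻ a a≈⊥ {x} x∈a with trans (sym x∈a) (a≈⊥ x)
... | ()

≈⊥-stable : ∀ a → ¬ ¬ (a ≈ ⊥) → a ≈ ⊥
≈⊥-stable a ¬¬a≈⊥ = ≈⊥⁺ a λ x∈a → ¬¬a≈⊥ λ a≈⊥ → ≈⊥⁻ a a≈⊥ x∈a

-- The first n coordinates of x, read as a binary numeral; it orders the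
-- cylinders of depth n lexicographically.
val : ℕ → 2^ω → ℕ
val zero    x = 0
val (suc n) x = (if x n then 1 else 0) ℕ.+ val n x ℕ.* 2

val-local : ∀ n x y → (∀ i → i ℕ.< n → x i ≡ y i) → val n x ≡ val n y
val-local zero    x y e = refl
val-local (suc n) x y e = cong₂ (λ b v → (if b then 1 else 0) ℕ.+ v ℕ.* 2)
  (e n (ℕ.n<1+n n)) (val-local n x y (λ i i<n → e i (ℕ.m<n⇒m<1+n i<n)))

bit≤1 : ∀ b → (if b then 1 else 0) ℕ.≤ 1
bit≤1 true  = ℕ.≤-refl
bit≤1 false = ℕ.z≤n

val<2^ : ∀ n x → val n x ℕ.< 2 ℕ.^ n
val<2^ zero    x = ℕ.s≤s ℕ.z≤n
val<2^ (suc n) x = ℕ.≤-trans (ℕ.s≤s (ℕ.+-monoˡ-≤ _ (bit≤1 (x n))))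
  (subst (suc (val n x) ℕ.* 2 ℕ.≤_) (ℕ.*-comm (2 ℕ.^ n) 2) (ℕ.*-monoˡ-≤ 2 (val<2^ n x)))

-- Appending a bit adds at most 1, whereas doubling widens a strict inequality to a gap of at least
-- 2.
val-mono : ∀ {m n} x y → m ℕ.≤′ n → val m x ℕ.< val m y → val n x ℕ.< val n y
val-mono x y ≤′-refl v<w = v<w
val-mono {n = suc n} x y (≤′-step m≤n) v<w =
  ℕ.≤-trans (ℕ.s≤s (ℕ.+-monoˡ-≤ _ (bit≤1 (x n))))
    (ℕ.≤-trans (ℕ.*-monoˡ-≤ 2 (val-mono x y m≤n v<w)) (ℕ.m≤n+m _ _))

val-cancel-≤ : ∀ {m n} x y → m ℕ.≤′ n → val n x ℕ.≤ val n y → val m x ℕ.≤ val m y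
val-cancel-≤ {m} x y m≤n v≤w = ℕ.≮⇒≥ (λ w<v → ℕ.<⇒≱ (val-mono y x m≤n w<v) v≤w)

val-cancel-≡ : ∀ {m n} x y → m ℕ.≤′ n → val n x ≡ val n y → val m x ≡ val m y
val-cancel-≡ x y m≤n e = ℕ.≤-antisym
  (val-cancel-≤ x y m≤n (ℕ.≤-reflexive e)) (val-cancel-≤ y x m≤n (ℕ.≤-reflexive (sym e)))

val-surjective : ∀ n {k} → k ℕ.< 2 ℕ.^ n → ∃ λ x → val n x ≡ k
val-surjective zero    {zero}  k<1 = const false , refl
val-surjective zero    {suc k} (ℕ.s≤s ())
val-surjective (suc n) {k} k<2^ =
  let y , e = val-surjective n
        (m<n*o⇒m/o<n {k} {2 ℕ.^ n} {2} (subst (k ℕ.<_) (ℕ.*-comm 2 (2 ℕ.^ n)) k<2^))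
      -- Coordinate `n` is the parity of `k`; the earlier ones, taken from `y`, encode `k / 2`.
      x = λ i → if does (i ℕ.≟ n) then odd else y i
      y≡x = λ i i<n → sym (cong (if_then odd else y i) (dec-false (i ℕ.≟ n) (ℕ.<⇒≢ i<n)))
  in x , trans (cong₂ (λ b v → (if b then 1 else 0) ℕ.+ v ℕ.* 2)
                 (cong (if_then odd else y n) (dec-true (n ℕ.≟ n) refl))
                 (trans (sym (val-local n y x y≡x)) e))
           (trans (cong (ℕ._+ (k ℕ./ 2) ℕ.* 2) (bit (k ℕ.% 2) (m%n<n k 2)))
             (sym (m≡m%n+[m/n]*n k 2)))
  where
  odd : Bool
  odd = does (k ℕ.% 2 ℕ.≟ 1)
  bit : ∀ r → r ℕ.< 2 → (if does (r ℕ.≟ 1) then 1 else 0) ≡ r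
  bit zero          _ = refl
  bit (suc zero)    _ = refl
  bit (suc (suc r)) (ℕ.s≤s (ℕ.s≤s ()))

-- Equal values at depth `n` are equal at all smaller depths, and the values at depths `i` and
-- `suc i` determine the bit at `i`.
val-injective : ∀ n x y → val n x ≡ val n y → ∀ i → i ℕ.< n → x i ≡ y i
val-injective n x y e i i<n = bit-injective (x i) (y i)
  (ℕ.+-cancelʳ-≡ (val i x ℕ.* 2) _ _
    (trans (val-cancel-≡ x y (ℕ.≤⇒≤′ i<n) e)
      (cong (λ v → (if y i then 1 else 0) ℕ.+ v ℕ.* 2)
        (sym (val-cancel-≡ x y (ℕ.≤⇒≤′ (ℕ.<⇒≤ i<n)) e)))))
  where
  bit-injective : ∀ b c → (if b then 1 else 0) ≡ (if c then 1 else 0) → b ≡ c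
  bit-injective true  true  _ = refl
  bit-injective false false _ = refl

select : {P : ℕ → Set} → (∀ k → Dec (P k)) → ℕ → Clopen
select P? n = record
  { χ     = λ x → does (P? (val n x))
  ; depth = n
  ; local = λ x y e → cong (does ∘ P?) (val-local n x y e)
  }

below : ℕ → ℕ → Clopen
below n k = select (ℕ._<? k) n

at : ℕ → ℕ → Clopen
at n k = select (ℕ._≟ k) n

between : ℕ → ℕ → ℕ → Clopen
between n k l = ∁ below n k ∧ below n l

∈-below⁺ : ∀ n k {x} → val n x ℕ.< k → x ∈ᶜ below n k
∈-below⁺ n k = dec-true (_ ℕ.<? _)

∈-below⁻ : ∀ n k {x} → x ∈ᶜ below n k → val n x ℕ.< k
∈-below⁻ n k = does-true (_ ℕ.<? _)

∈-at⁺ : ∀ n k {x} → val n x ≡ k → x ∈ᶜ at n k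
∈-at⁺ n k = dec-true (_ ℕ.≟ _)

∈-at⁻ : ∀ n k {x} → x ∈ᶜ at n k → val n x ≡ k
∈-at⁻ n k = does-true (_ ℕ.≟ _)

∈-between⁻ : ∀ n k l {x} → x ∈ᶜ between n k l → k ℕ.≤ val n x × val n x ℕ.< l
∈-between⁻ n k l {x} x∈ =
  let x∈₁ , x∈₂ = ∈ᶜ-∧⁻ (∁ below n k) (below n l) x∈
  in ℕ.≮⇒≥ (∈ᶜ-∁ (below n k) x∈₁ ∘ ∈-below⁺ n k) , ∈-below⁻ n l x∈₂

below-suc : ∀ n k → below n (suc k) ≈ below n k ∨ at n k
below-suc n k x with ℕ.<-cmp (val n x) k
... | tri< v<k _ _ = trans (∈-below⁺ n (suc k) {x} (ℕ.m<n⇒m<1+n v<k))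
  (sym (∈ᶜ-∨⁺ (below n k) (at n k) {x} (inj₁ (∈-below⁺ n k {x} v<k))))
... | tri≈ _ v≡k _ = trans (∈-below⁺ n (suc k) {x} (ℕ.s≤s (ℕ.≤-reflexive v≡k)))
  (sym (∈ᶜ-∨⁺ (below n k) (at n k) {x} (inj₂ (∈-at⁺ n k {x} v≡k))))
... | tri> v≮k v≢k k<v = trans (dec-false (_ ℕ.<? _) (ℕ.≤⇒≯ k<v))
  (sym (cong₂ Bool._∨_ (dec-false (_ ℕ.<? _) v≮k) (dec-false (_ ℕ.≟ _) v≢k)))

below-at-disjoint : ∀ n k → below n k ∧ at n k ≈ ⊥
below-at-disjoint n k = disjoint⁺ (below n k) (at n k)
  λ {x} x∈ x∈′ → ℕ.<⇒≢ (∈-below⁻ n k x∈) (∈-at⁻ n k x∈′)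

below-mono : ∀ n {k l} → k ℕ.≤ l → below n k ≤ below n l
below-mono n {k} {l} k≤l = ≤⁺ (below n k) (below n l)
  λ {x} x∈ → ∈-below⁺ n l (ℕ.<-≤-trans (∈-below⁻ n k x∈) k≤l)

below-full : ∀ n → ⊤ ≤ below n (2 ℕ.^ n)
below-full n = ≤⁺ ⊤ (below n (2 ℕ.^ n)) λ {x} _ → ∈-below⁺ n (2 ℕ.^ n) (val<2^ n x)

-- Together with `below-shallow` this says that the intervals of the cylinders around `x` are
-- nested: with growing depth left endpoints rise and right endpoints fall.
below-deepen : ∀ {m n} x → m ℕ.≤ n → below m (val m x) ≤ below n (val n x)
below-deepen {m} {n} x m≤n = ≤⁺ (below m (val m x)) (below n (val n x))
  λ {z} z∈ → ∈-below⁺ n (val n x) (val-mono z x (ℕ.≤⇒≤′ m≤n) (∈-below⁻ m (val m x) z∈))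

below-shallow : ∀ {m n} x → m ℕ.≤ n → below n (suc (val n x)) ≤ below m (suc (val m x))
below-shallow {m} {n} x m≤n = ≤⁺ (below n (suc (val n x))) (below m (suc (val m x)))
  λ {z} z∈ → ∈-below⁺ m (suc (val m x)) (ℕ.s≤s (val-cancel-≤ z x (ℕ.≤⇒≤′ m≤n)
    (ℕ.s≤s⁻¹ (∈-below⁻ n (suc (val n x)) z∈))))

at-local : ∀ a {n} x → depth a ℕ.≤ n → ∀ {y} → y ∈ᶜ at n (val n x) → χ a y ≡ χ a x
at-local a {n} x d≤n {y} y∈ = local a y x λ i i<d →
  val-injective n y x (∈-at⁻ n (val n x) y∈) i (ℕ.<-≤-trans i<d d≤n)

-- Intervals of a measure

<ᴿ-asym : ∀ x y → x <ᴿ y → y <ᴿ x → Empty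
<ᴿ-asym x y (p , p∈Ux , p∈Ly) (q , q∈Uy , q∈Lx) =
  ℚ.<-asym (ℝ.disjoint x q∈Lx p∈Ux) (ℝ.disjoint y p∈Ly q∈Uy)

<ᴿ-mono : ∀ x y x′ y′ → x′ ≤ᴿ x → y ≤ᴿ y′ → x <ᴿ y → x′ <ᴿ y′
<ᴿ-mono x y x′ y′ x′≤x y≤y′ (q , q∈U , q∈L) = q , ≤ᴿ⇒U⊇ x′ x x′≤x q∈U , y≤y′ q∈L

room : ∀ x {p} → p ∈ L x → ∃ λ δ → 0ℚ ℚ.< δ × (p ℚ.+ (δ ℚ.+ δ ℚ.+ δ ℚ.+ δ ℚ.+ δ)) ∈ L x
room x {p} p∈ =
  let q , p<q , q∈ = ℝ.L-open x p∈
  in ⅕ ℚ.* (q ℚ.- p) ,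
     subst (ℚ._< ⅕ ℚ.* (q ℚ.- p)) (ℚ.*-zeroʳ ⅕) (ℚ.*-monoʳ-<-pos ⅕ (p<q⇒0<q-p p<q)) ,
     subst (_∈ L x) (sym (lem p q)) q∈
  where
  ⅕ : ℚ
  ⅕ = ℚ.1ℚ ℚ.÷ (Data.Integer.+ 5 ℚ./ 1)
    where import Data.Integer
  open +-*-Solver
  lem : ∀ p q → let δ = ⅕ ℚ.* (q ℚ.- p) in p ℚ.+ (δ ℚ.+ δ ℚ.+ δ ℚ.+ δ ℚ.+ δ) ≡ q
  lem = solve 2 (λ p q → let δ = con ⅕ :* (q :- p) in p :+ (δ :+ δ :+ δ :+ δ :+ δ) := q) refl

-- A discrete intermediate value theorem. The gap between `r` and `s` lets `locate` decide each step
-- of the downward search.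
crossing : ∀ (f : ℕ → ℝ) {r s} → r ℚ.< s → ¬ r ∈ L (f 0) → ∀ k → r ∈ L (f k) →
           ∃ λ l → l ℕ.< k × s ∈ U (f l) × r ∈ L (f (suc l))
crossing f r<s r∉ zero    r∈ = ⊥-elim (r∉ r∈)
crossing f r<s r∉ (suc k) r∈ with locate (f k) r<s
... | inj₁ r∈k = let l , l<k , h = crossing f r<s r∉ k r∈k in l , ℕ.m<n⇒m<1+n l<k , h
... | inj₂ s∈k = k , ℕ.n<1+n k , s∈k , r∈

module _ (μ : Measure 𝔄c) where

  cdf : ℕ → ℕ → ℝ
  cdf n k = measure μ (below n k)

  cdf-mono : ∀ n {k l} → k ℕ.≤ l → cdf n k ≤ᴿ cdf n l
  cdf-mono n k≤l = monotone μ (below-mono n k≤l)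

  cdf-suc : ∀ n k → cdf n (suc k) ≈ᴿ cdf n k +ᴿ measure μ (at n k)
  cdf-suc n k =
    let p , q = measure-cong μ {below n (suc k)} {below n k ∨ at n k} (below-suc n k)
        r , s = additive μ (below n k) (at n k) (below-at-disjoint n k)
    in r ∘ p , q ∘ s

  cdf-crossing : ∀ n {r s} → 0ℚ ℚ.≤ r → r ℚ.< s → r ℚ.< 1ℚ → ∃ λ x →
    s ∈ U (cdf n (val n x)) × r ∈ L (cdf n (suc (val n x)))
  cdf-crossing n 0≤r r<s r<1 =
    let l , l<2^n , s∈ , r∈ = crossing (cdf n) r<s
          (λ r∈ → ℚ.<-irrefl refl
            (ℚ.<-≤-trans (L-null μ (below n 0) (λ _ → refl) r∈) 0≤r))
          (2 ℕ.^ n) (monotone μ (below-full n) (proj₂ (unit μ) r<1))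
        x , e = val-surjective n l<2^n
    in x , subst (λ l → _ ∈ U (cdf n l) × _ ∈ L (cdf n (suc l))) (sym e) (s∈ , r∈)

  SmallCylinders : Set
  SmallCylinders = ∀ {δ} → 0ℚ ℚ.< δ → ∃ λ n → ∀ x → δ ∈ U (measure μ (at n (val n x)))

  -- Take a partition into pieces of measure at most `q < δ`. At a depth bounding those of all
  -- pieces, each cylinder lies inside a single piece.
  nonAtomic⇒smallCylinders : NonAtomic μ → SmallCylinders
  nonAtomic⇒smallCylinders nonAtomic {δ} 0<δ =
    let q , 0<q , q<δ = ℚ.<-dense 0<δ
        as , _ , cover , small = nonAtomic (fromℚ q) (q′ 0<q)
        n , h = common as small
    in n , λ x → h x (cover x) q<δ
    where
    q′ : ∀ {q} → 0ℚ ℚ.< q → 0ᴿ <ᴿ fromℚ q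
    q′ 0<q = let r , 0<r , r<q = ℚ.<-dense 0<q in r , 0<r , r<q

    common : ∀ {q} as → All (λ a → measure μ a ≤ᴿ fromℚ q) as → ∃ λ n → ∀ x →
             x ∈ᶜ foldr _∨_ ⊥ as → ∀ {p} → q ℚ.< p → p ∈ U (measure μ (at n (val n x)))
    common []       []             = 0 , λ x ()
    common {q} (a ∷ as) (small ∷ smalls) =
      let n , h = common as smalls
          m     = depth a ℕ.⊔ n
      in m , λ x x∈ q<p → [
        (λ x∈a → ≤ᴿ⇒U⊇ (measure μ (at m (val m x))) (fromℚ q)
          (small ∘ monotone μ (≤⁺ (at m (val m x)) a λ y∈ →
            trans (at-local a x (ℕ.m≤m⊔n (depth a) n) y∈) x∈a)) q<p) ,
        (λ x∈as → ≤ᴿ⇒U⊇ (measure μ (at m (val m x))) (measure μ (at n (val n x)))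
          (monotone μ (≤⁺ (at m (val m x)) (at n (val n x)) λ {y} y∈ →
            ∈-at⁺ n (val n x) (val-cancel-≡ y x (ℕ.≤⇒≤′ (ℕ.m≤n⊔m (depth a) n))
              (∈-at⁻ m (val m x) y∈)))) (h x x∈as q<p)) ]′ (∈ᶜ-∨⁻ a (foldr _∨_ ⊥ as) x∈)

-- Apartness of clopen sets

module _ (μ ν : Measure 𝔄c) where

  -- μ sends the cylinder of depth n around x to the interval from
  -- cdf μ n (val n x) to cdf μ n (suc (val n x)), and likewise for ν.
  Overlap : ℕ → 2^ω → 2^ω → Set
  Overlap n x y = cdf μ n (val n x) <ᴿ cdf ν n (suc (val n y))
                × cdf ν n (val n y) <ᴿ cdf μ n (suc (val n x))

  Apart : Clopen → Clopen → Set
  Apart a b = ∃ λ n → ∀ {x y} → x ∈ᶜ a → y ∈ᶜ b → ¬ Overlap n x y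

  -- Inner approximation is isolated for one set at a time so that it can be assembled from
  -- cylinders.
  Inscribable : Clopen → Set
  Inscribable c = ∀ {p} → p ∈ L (measure μ c) →
                  ∃ λ b → Apart (∁ c) b × p ∈ L (measure ν b)

Apart-sym : ∀ μ ν {a b} → Apart μ ν a b → Apart ν μ b a
Apart-sym μ ν (n , h) = n , λ y∈b x∈a → h x∈a y∈b ∘ swap

module _ (μ ν : Measure 𝔄c) where

  -- Nested intervals overlap all the more at smaller depths; two apartness witnesses can thus be
  -- compared at the larger of their depths.
  Overlap-coarsen : ∀ {m n} x y → m ℕ.≤ n → Overlap μ ν n x y → Overlap μ ν m x y
  Overlap-coarsen {m} {n} x y m≤n (p , q) =
    <ᴿ-mono (cdf μ n (val n x)) (cdf ν n (suc (val n y)))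
            (cdf μ m (val m x)) (cdf ν m (suc (val m y)))
      (monotone μ (below-deepen x m≤n)) (monotone ν (below-shallow y m≤n)) p ,
    <ᴿ-mono (cdf ν n (val n y)) (cdf μ n (suc (val n x)))
            (cdf ν m (val m y)) (cdf μ m (suc (val m x)))
      (monotone ν (below-deepen y m≤n)) (monotone μ (below-shallow x m≤n)) q

  Apart-anti : ∀ a a′ b → (∀ {x} → x ∈ᶜ a′ → x ∈ᶜ a) → Apart μ ν a b → Apart μ ν a′ b
  Apart-anti a a′ b a′⊆a (n , h) = n , λ x∈ → h (a′⊆a x∈)

  Apart-∨ : ∀ a b b′ → Apart μ ν a b → Apart μ ν a b′ → Apart μ ν a (b ∨ b′)
  Apart-∨ a b b′ (m , h) (n , h′) = m ℕ.⊔ n , λ {x} {y} x∈ y∈ o →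
    [ (λ y∈b → h x∈ y∈b (Overlap-coarsen x y (ℕ.m≤m⊔n m n) o))
    , (λ y∈b′ → h′ x∈ y∈b′ (Overlap-coarsen x y (ℕ.m≤n⊔m m n) o)) ]′
    (∈ᶜ-∨⁻ b b′ y∈)

  -- The interval of `y` is nondegenerate, so it contains rationals `t + q < t + q′`. The cumulative
  -- measure of `μ` runs from 0 to 1 and must cross between them, at the cylinder of `x`.
  overlap-exists : StrictlyPositive ν → ∀ n y → ∃ λ x → Overlap μ ν n x y
  overlap-exists positive n y =
    let v = val n y
        q , 0<q , q∈ = positive (at n v) λ at≈⊥ → ≈⊥⁻ (at n v) at≈⊥ (∈-at⁺ n v {y} refl)
        q′ , q<q′ , q′∈ = ℝ.L-open (measure ν (at n v)) q∈
        t , t∈ , t+q∈ = ℝ.tight (cdf ν n v) 0<q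
        t+q<t+q′ = ℚ.+-monoʳ-< t q<q′
        t+q′∈ = proj₂ (cdf-suc ν n v) (t , q′ , t∈ , q′∈ , refl)
        x , s∈ , r∈ = cdf-crossing μ n (U-bounded ν (below n v) t+q∈) t+q<t+q′
          (ℚ.<-trans t+q<t+q′ (L-bounded ν (below n (suc v)) t+q′∈))
    in x , (t ℚ.+ q′ , s∈ , t+q′∈) , (t ℚ.+ q , t+q∈ , r∈)

  -- A common point `y` of `b` and `b′` would overlap some `x`, which belongs to `a` or to `a′`.
  Apart-cover : StrictlyPositive ν → ∀ a a′ b b′ → Apart μ ν a b → Apart μ ν a′ b′ →
                (∀ x → x ∈ᶜ a ⊎ x ∈ᶜ a′) → b ∧ b′ ≈ ⊥
  Apart-cover positive a a′ b b′ (m , h) (n , h′) cover = disjoint⁺ b b′ λ {y} y∈b y∈b′ →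
    let x , o = overlap-exists positive (m ℕ.⊔ n) y
    in [ (λ x∈a → h x∈a y∈b (Overlap-coarsen x y (ℕ.m≤m⊔n m n) o))
       , (λ x∈a′ → h′ x∈a′ y∈b′ (Overlap-coarsen x y (ℕ.m≤n⊔m m n) o)) ]′ (cover x)

  -- Approximation in measure from inside and outside

  Inscribable-cong : ∀ {c c′} → c ≈ c′ → Inscribable μ ν c → Inscribable μ ν c′
  Inscribable-cong {c} {c′} c≈c′ inscribe p∈ =
    let b , apart , p∈b = inscribe (proj₂ (measure-cong μ {c} {c′} c≈c′) p∈)
    in b , Apart-anti (∁ c) (∁ c′) b (λ {x} → trans (cong Bool.not (c≈c′ x))) apart , p∈b

  inscribe-negative : ∀ c {p} → p ℚ.< 0ℚ → ∃ λ b → Apart μ ν (∁ c) b × p ∈ L (measure ν b)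
  inscribe-negative c p<0 = ⊥ , (0 , λ _ ()) , nonNeg ν ⊥ p<0

  inscribe-⊥ : Inscribable μ ν ⊥
  inscribe-⊥ p∈ = inscribe-negative ⊥ (L-null μ ⊥ (λ _ → refl) p∈)

  -- The complements of disjoint sets form a cover, so by `Apart-cover` the two inscribed sets are
  -- disjoint and their measures add.
  inscribe-∨ : StrictlyPositive ν → ∀ c d → c ∧ d ≈ ⊥ →
               Inscribable μ ν c → Inscribable μ ν d → Inscribable μ ν (c ∨ d)
  inscribe-∨ positive c d c∧d≈⊥ inscribe-c inscribe-d p∈ =
    let q , r , q∈c , r∈d , q+r≡p = proj₁ (additive μ c d c∧d≈⊥) p∈
        b , apart , q∈b = inscribe-c q∈c
        b′ , apart′ , r∈b′ = inscribe-d r∈d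
        b∧b′≈⊥ = Apart-cover positive (∁ c) (∁ d) b b′ apart apart′ λ x →
          [ (λ x∈c → inj₂ (∉ᶜ⇒∈ᶜ-∁ d (disjoint⁻ c d c∧d≈⊥ x∈c))) , inj₁ ]′ (∈ᶜ-cases c x)
    in b ∨ b′ ,
       Apart-∨ (∁ (c ∨ d)) b b′
         (Apart-anti (∁ c) (∁ (c ∨ d)) b (λ x∈ → ∉ᶜ⇒∈ᶜ-∁ c (∈ᶜ-∁ (c ∨ d) x∈ ∘ ∈ᶜ-∨⁺ c d ∘ inj₁)) apart)
         (Apart-anti (∁ d) (∁ (c ∨ d)) b′ (λ x∈ → ∉ᶜ⇒∈ᶜ-∁ d (∈ᶜ-∁ (c ∨ d) x∈ ∘ ∈ᶜ-∨⁺ c d ∘ inj₂)) apart′) ,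
       proj₂ (additive ν b b′ b∧b′≈⊥) (q , r , q∈b , r∈b′ , q+r≡p)

  -- Fitting endpoints of depth-m cylinders of ν to the interval of at n k
  -- costs at most 3δ on the left and 2δ on the right, hence `room` for 5δ.
  inscribe-at : SmallCylinders ν → ∀ n k → Inscribable μ ν (at n k)
  inscribe-at small n k {p} p∈ with p ℚ.<? 0ℚ
  ... | yes p<0 = inscribe-negative (at n k) p<0
  -- From `0 ≤ p` it follows that `r₀` lies below `r₁`; for negative `p` the empty set was enough.
  ... | no  p≮0 =
    let δ , 0<δ , p+5δ∈ = room (measure μ (at n k)) p∈
        t , t∈ , t+δ∈ = ℝ.tight (cdf μ n k) 0<δ
        m , h  = small 0<δ
        N      = n ℕ.⊔ m
        r₀     = t ℚ.+ δ
        s₀     = r₀ ℚ.+ δ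
        s₁     = t ℚ.+ (p ℚ.+ (δ ℚ.+ δ ℚ.+ δ ℚ.+ δ ℚ.+ δ))
        r₁     = s₁ ℚ.- δ
        s₁∈    = proj₂ (cdf-suc μ n k) (t , _ , t∈ , p+5δ∈ , refl)
        r₁<s₁  = subst (r₁ ℚ.<_) ([q-p]+p δ s₁) (p<p+d r₁ 0<δ)
        r₀<r₁  = subst (r₀ ℚ.<_) (lem₁ t p δ) (p<p+d r₀ (ℚ.+-mono-≤-<
                   (ℚ.≮⇒≥ p≮0) (ℚ.+-mono-< (ℚ.+-mono-< 0<δ 0<δ) 0<δ)))
        0≤r₀   = U-bounded μ (below n k) t+δ∈
        r₁<1   = ℚ.<-trans r₁<s₁ (L-bounded μ (below n (suc k)) s₁∈)
        x₀ , s₀∈ , r₀∈ = cdf-crossing ν N 0≤r₀ (p<p+d r₀ 0<δ) (ℚ.<-trans r₀<r₁ r₁<1)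
        x₁ , s₁∈′ , r₁∈ = cdf-crossing ν N (ℚ.≤-trans 0≤r₀ (ℚ.<⇒≤ r₀<r₁)) r₁<s₁ r₁<1
        -- The successor skips the cylinder of `x₀`, which may stick out on the left; stopping
        -- before `l₁` skips that of `x₁`, which may stick out on the right.
        l₀     = suc (val N x₀)
        l₁     = val N x₁
        δ∈     = λ x → ≤ᴿ⇒U⊇ (measure ν (at N (val N x))) (measure ν (at m (val m x)))
                   (monotone ν (≤⁺ (at N (val N x)) (at m (val m x)) λ {y} y∈ →
                     ∈-at⁺ m (val m x) (val-cancel-≡ y x (ℕ.≤⇒≤′ (ℕ.m≤n⊔m n m))
                       (∈-at⁻ N (val N x) y∈)))) (h x)
        s₀+δ∈  = ≤ᴿ⇒U⊇ (cdf ν N l₀) (cdf ν N (val N x₀) +ᴿ measure ν (at N (val N x₀)))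
                   (proj₁ (cdf-suc ν N (val N x₀))) (s₀ , δ , s₀∈ , δ∈ x₀ , refl)
        r₁-δ∈  = difference′ (measure ν (at N l₁)) (cdf ν N l₁) (cdf ν N (suc l₁))
                   (λ q∈ → +ᴿ-comm (cdf ν N l₁) (measure ν (at N l₁)) (proj₁ (cdf-suc ν N l₁) q∈))
                   (δ∈ x₁) r₁∈
        b      = between N l₀ l₁
    in b ,
       (N , λ {x} {y} x∈ y∈ (o , o′) →
         let l₀≤y , y<l₁ = ∈-between⁻ N l₀ l₁ y∈
         in separated N x y (∈ᶜ-∁ (at n k) x∈ ∘ ∈-at⁺ n k) (ℕ.m≤m⊔n n m)
              (r₀ , t+δ∈ , cdf-mono ν N l₀≤y r₀∈)
              (s₁ , ≤ᴿ⇒U⊇ (cdf ν N (suc (val N y))) (cdf ν N l₁) (cdf-mono ν N y<l₁) s₁∈′ , s₁∈)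
              o o′) ,
       subst (_∈ L (measure ν b)) (lem₂ t p δ)
         (difference′ (cdf ν N l₀) (measure ν b) (cdf ν N l₁)
           (cdf-between N l₀ l₁) s₀+δ∈ r₁-δ∈)
    where
    -- A point `x` off the cylinder is to its left or right, and by nesting its interval stays on
    -- that side of the cylinder's interval, which strictly contains that of `y`.
    separated : ∀ N x y → val n x ≢ k → n ℕ.≤ N →
      cdf μ n k <ᴿ cdf ν N (val N y) → cdf ν N (suc (val N y)) <ᴿ cdf μ n (suc k) →
      cdf μ N (val N x) <ᴿ cdf ν N (suc (val N y)) →
      ¬ cdf ν N (val N y) <ᴿ cdf μ N (suc (val N x))
    separated N x y x≢k n≤N left right o o′ with ℕ.<-cmp (val n x) k
    ... | tri< x<k _ _ = <ᴿ-asym (cdf μ n k) (cdf ν N (val N y)) left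
      (<ᴿ-mono (cdf ν N (val N y)) (cdf μ N (suc (val N x))) (cdf ν N (val N y)) (cdf μ n k) id
        (cdf-mono μ n x<k ∘ monotone μ (below-shallow x n≤N)) o′)
    ... | tri≈ _ x≡k _ = x≢k x≡k
    ... | tri> _ _ k<x = <ᴿ-asym (cdf ν N (suc (val N y))) (cdf μ n (suc k)) right
      (<ᴿ-mono (cdf μ N (val N x)) (cdf ν N (suc (val N y))) (cdf μ n (suc k))
        (cdf ν N (suc (val N y)))
        (monotone μ (below-deepen x n≤N) ∘ cdf-mono μ n k<x) id o)

    +ᴿ-comm : ∀ x y → x +ᴿ y ≤ᴿ y +ᴿ x
    +ᴿ-comm x y (p , q , p∈ , q∈ , p+q≡r) = q , p , q∈ , p∈ , trans (ℚ.+-comm q p) p+q≡r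

    cdf-between : ∀ N l l′ → cdf ν N l′ ≤ᴿ cdf ν N l +ᴿ measure ν (between N l l′)
    cdf-between N l l′ =
      proj₁ (additive ν (below N l) (between N l l′)
        (disjoint⁺ (below N l) (between N l l′) λ x∈ x∈′ →
          ∈ᶜ-∁ (below N l) (proj₁ (∈ᶜ-∧⁻ (∁ below N l) (below N l′) x∈′)) x∈)) ∘
      monotone ν (≤⁺ (below N l′) (below N l ∨ between N l l′) λ {x} x∈ →
        ∈ᶜ-∨⁺ (below N l) (between N l l′)
          ([ inj₁ , (λ x∉ → inj₂ (∈ᶜ-∧⁺ (∁ below N l) (below N l′) x∉ x∈)) ]′
            (∈ᶜ-cases (below N l) x)))

    open +-*-Solver
    lem₁ : ∀ t p δ → (t ℚ.+ δ) ℚ.+ (p ℚ.+ (δ ℚ.+ δ ℚ.+ δ))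
                     ≡ (t ℚ.+ (p ℚ.+ (δ ℚ.+ δ ℚ.+ δ ℚ.+ δ ℚ.+ δ))) ℚ.- δ
    lem₁ = solve 3 (λ t p δ → (t :+ δ) :+ (p :+ (δ :+ δ :+ δ)) :=
      (t :+ (p :+ (δ :+ δ :+ δ :+ δ :+ δ))) :- δ) refl
    lem₂ : ∀ t p δ → (((t ℚ.+ (p ℚ.+ (δ ℚ.+ δ ℚ.+ δ ℚ.+ δ ℚ.+ δ))) ℚ.- δ) ℚ.- δ)
                     ℚ.- (((t ℚ.+ δ) ℚ.+ δ) ℚ.+ δ) ≡ p
    lem₂ = solve 3 (λ t p δ → (((t :+ (p :+ (δ :+ δ :+ δ :+ δ :+ δ))) :- δ) :- δ)
      :- (((t :+ δ) :+ δ) :+ δ) := p) refl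

  -- At its own depth `c` either contains or misses each cylinder, so it is a finite disjoint union
  -- of cylinders, added here in lexicographic order.
  inscribe : StrictlyPositive ν → SmallCylinders ν → ∀ c → Inscribable μ ν c
  inscribe positive small c = Inscribable-cong {c ∧ below n (2 ℕ.^ n)} {c}
    (λ x → trans (cong (χ c x Bool.∧_) (∈-below⁺ n (2 ℕ.^ n) {x} (val<2^ n x)))
             (Bool.∧-identityʳ (χ c x)))
    (upTo (2 ℕ.^ n) ℕ.≤-refl)
    where
    n : ℕ
    n = depth c

    cylinder : ∀ k → k ℕ.< 2 ℕ.^ n → Inscribable μ ν (c ∧ at n k)
    cylinder k k<2^n with val-surjective n k<2^n
    ... | x , refl with ∈ᶜ-cases c x
    ... | inj₁ x∈c = Inscribable-cong {at n (val n x)} {c ∧ at n (val n x)}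
      ⇒∧ (inscribe-at small n (val n x))
      where
      ⇒∧ : at n (val n x) ≈ c ∧ at n (val n x)
      ⇒∧ y with χ (at n (val n x)) y in e
      ... | true  = sym (trans (Bool.∧-identityʳ (χ c y)) (trans (at-local c x ℕ.≤-refl {y} e) x∈c))
      ... | false = sym (Bool.∧-zeroʳ (χ c y))
    ... | inj₂ x∉c = Inscribable-cong {⊥} {c ∧ at n (val n x)}
      (sym ∘ disjoint⁺ c (at n (val n x)) λ {y} y∈c y∈ →
        ∈ᶜ-∁ c x∉c (trans (sym (at-local c x ℕ.≤-refl {y} y∈)) y∈c)) inscribe-⊥

    upTo : ∀ k → k ℕ.≤ 2 ℕ.^ n → Inscribable μ ν (c ∧ below n k)
    upTo zero    _ = Inscribable-cong {⊥} {c ∧ below n 0}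
      (λ x → sym (Bool.∧-zeroʳ (χ c x))) inscribe-⊥
    upTo (suc k) k<2^n = Inscribable-cong {(c ∧ below n k) ∨ (c ∧ at n k)} {c ∧ below n (suc k)}
      (λ x → sym (trans (cong (χ c x Bool.∧_) (below-suc n k x))
               (Bool.∧-distribˡ-∨ (χ c x) (χ (below n k) x) (χ (at n k) x))))
      (inscribe-∨ positive (c ∧ below n k) (c ∧ at n k)
        (disjoint⁺ (c ∧ below n k) (c ∧ at n k) λ {x} x∈ x∈′ →
          disjoint⁻ (below n k) (at n k) (below-at-disjoint n k)
            (proj₂ (∈ᶜ-∧⁻ c (below n k) x∈)) (proj₂ (∈ᶜ-∧⁻ c (at n k) x∈′)))
        (upTo k (ℕ.<⇒≤ k<2^n)) (cylinder k k<2^n))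

  -- Dual to `inscribe` by complementation. The slack `q - q′` is halved to obtain strict
  -- inequalities on both sides of 1.
  circumscribe : (∀ c → Inscribable μ ν c) → ∀ c {q} → q ∈ U (measure μ c) →
                 ∃ λ b → Apart μ ν c (∁ b) × q ∈ U (measure ν b)
  circumscribe inscribe c {q} q∈ =
    let q′ , q′<q , q′∈ = ℝ.U-open (measure μ c) q∈
        h   = ½ ℚ.* (q ℚ.- q′)
        0<h = 0<½p (p<q⇒0<q-p q′<q)
        b , apart , w∈ = inscribe (∁ c) (difference′ (measure μ c) (measure μ (∁ c)) 1ᴿ
          (proj₂ (total μ c)) q′∈ (subst (1ℚ ℚ.- h ℚ.<_) ([q-p]+p h 1ℚ) (p<p+d (1ℚ ℚ.- h) 0<h)))
    in ∁ b ,
       Apart-anti (∁ ∁ c) c (∁ ∁ b) (λ {x} → trans (Bool.not-involutive (χ c x)))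
         (map-right (∁ ∁ c) b (∁ ∁ b) (λ {x} → trans (sym (Bool.not-involutive (χ b x)))) apart) ,
       difference (measure ν b) (measure ν (∁ b)) 1ᴿ (proj₁ (total ν b)) w∈
         (subst (1ℚ ℚ.<_) (lem q q′) (p<p+d 1ℚ 0<h))
    where
    map-right : ∀ a b b′ → (∀ {y} → y ∈ᶜ b′ → y ∈ᶜ b) → Apart μ ν a b → Apart μ ν a b′
    map-right a b b′ b′⊆b (n , h) = n , λ x∈ y∈ → h x∈ (b′⊆b y∈)
    open +-*-Solver
    lem : ∀ q q′ → let h = ½ ℚ.* (q ℚ.- q′) in 1ℚ ℚ.+ h ≡ ((1ℚ ℚ.- h) ℚ.- q′) ℚ.+ q
    lem = solve 2 (λ q q′ → let h = con ½ :* (q :- q′) in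
      con 1ℚ :+ h := ((con 1ℚ :- h) :- q′) :+ q) refl

-- Lebesgue measure

½^n≤1/[1+n] : ∀ n → toℚᵘ (½^ n) ℚᵘ.≤ mkℚᵘ (+ 1) n
½^n≤1/[1+n] zero    = ℚᵘ.≤-refl
½^n≤1/[1+n] (suc n) = ℚᵘ.≤-trans (ℚᵘ.≤-reflexive (ℚ.toℚᵘ-homo-* ½ (½^ n)))
  (ℚᵘ.≤-trans (ℚᵘ.*-monoʳ-≤-nonNeg (toℚᵘ ½) (½^n≤1/[1+n] n))
    -- Unnormalised fractions reduce the step to `2 + n ≤ 2 * (1 + n)` in the naturals.
    (ℚᵘ.*≤* (ℤ.+≤+ (subst₂ ℕ._≤_ (sym (ℕ.*-identityˡ (2 ℕ.+ n))) (sym (ℕ.*-identityˡ (2 ℕ.* suc n)))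
      (ℕ.s≤s (ℕ.≤-trans (ℕ.≤-reflexive (ℕ.+-comm 1 n)) (ℕ.+-monoʳ-≤ n (ℕ.s≤s ℕ.z≤n))))))))

-- For `δ` = (k+1)/(d+1) the exponent d+1 works, since its power of one half is at most 1/(d+2),
-- which is less than 1/(d+1).
∃½^n< : ∀ {δ} → 0ℚ ℚ.< δ → ∃ λ n → ½^ n ℚ.< δ
∃½^n< {δ@(ℚ.mkℚ +[1+ k ] d _)} _ = suc d , ℚ.toℚᵘ-cancel-<
  (ℚᵘ.≤-<-trans (½^n≤1/[1+n] (suc d)) (ℚᵘ.*<* (ℤ.+<+ (
    ℕ.≤-<-trans (ℕ.≤-reflexive (ℕ.*-identityˡ (suc d)))
      (ℕ.<-≤-trans (ℕ.n<1+n (suc d)) (ℕ.m≤n*m (2 ℕ.+ d) (suc k)))))))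
∃½^n< {ℚ.mkℚ (+ 0) d _} 0<δ = ⊥-elim (ℚ.<⇒≢ 0<δ (sym (ℚ.↥p≡0⇒p≡0 _ refl)))
∃½^n< {ℚ.mkℚ ℤ.-[1+ k ] d _} (ℚ.*<* ())

prefix : ∀ n → 2^ω → Vec Bool n
prefix zero    x = []
prefix (suc n) x = x 0 ∷ prefix n (x ∘ suc)

∈-[prefix] : ∀ n {x y} → (∀ i → i ℕ.< n → y i ≡ x i) → y ∈ᶜ [ prefix n x ]
∈-[prefix] zero    e = refl
∈-[prefix] (suc n) e = cong₂ Bool._∧_ (dec-true (_ Bool.≟ _) (e 0 (ℕ.s≤s ℕ.z≤n)))
  (∈-[prefix] n λ i i<n → e (suc i) (ℕ.s≤s i<n))

lebesgue-smallCylinders : SmallCylinders lebesgue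
lebesgue-smallCylinders {δ} 0<δ =
  let n , ½^n<δ = ∃½^n< 0<δ
  in n , λ x → ≤ᴿ⇒U⊇ (measure lebesgue (at n (val n x))) (fromℚ (½^ n))
       (proj₁ (lebesgue-cylinder (prefix n x)) ∘
        monotone lebesgue {at n (val n x)} {[ prefix n x ]} (≤⁺ (at n (val n x)) [ prefix n x ] λ {y} y∈ →
          ∈-[prefix] n (val-injective n y x (∈-at⁻ n (val n x) y∈)))) ½^n<δ

proportion-positive : ∀ n χ → LocalTo n χ → ∀ x → χ x ≡ true → 0ℚ ℚ.< proportion n χ
proportion-positive zero    χ loc x χx = subst (λ b → 0ℚ ℚ.< (if b then 1ℚ else 0ℚ))
  (trans (sym χx) (loc x (const false) λ _ ())) (ℚ.positive⁻¹ 1ℚ)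
proportion-positive (suc n) χ loc x χx = 0<½p (half (x 0)
  -- Splitting `x` into head and tail returns it only pointwise, so locality of `χ` replaces
  -- function extensionality.
  (trans (loc (x 0 ∷ω x ∘ suc) x λ where
    zero    _ → refl
    (suc i) _ → refl) χx))
  where
  half : ∀ b → χ (b ∷ω x ∘ suc) ≡ true →
         0ℚ ℚ.< proportion n (χ ∘ (false ∷ω_)) ℚ.+ proportion n (χ ∘ (true ∷ω_))
  half false e = ℚ.+-mono-<-≤
    (proportion-positive n (χ ∘ (false ∷ω_)) (∷-local {χ = χ} false loc) (x ∘ suc) e)
    (proportion-nonNeg n (χ ∘ (true ∷ω_)))
  half true  e = ℚ.+-mono-≤-<
    (proportion-nonNeg n (χ ∘ (false ∷ω_)))
    (proportion-positive n (χ ∘ (true ∷ω_)) (∷-local {χ = χ} true loc) (x ∘ suc) e)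

lebesgue-strictlyPositive : StrictlyPositive lebesgue
lebesgue-strictlyPositive a a≉⊥ with 0ℚ ℚ.<? proportion (depth a) (χ a)
... | yes 0<v = ℚ.<-dense 0<v
... | no  0≮v = ⊥-elim (a≉⊥ (≈⊥⁺ a λ {x} x∈a →
  0≮v (proportion-positive (depth a) (χ a) (local a) x x∈a)))

-- Separation of two measures on the Cantor algebra

clopenSeparation : ∀ μ ν → StrictlyPositive ν → SmallCylinders ν → Separation μ ν (Apart μ ν)
clopenSeparation μ ν positive small = record
  { cover        = λ {a} {a′} {b} {b′} a⟂b a′⟂b′ a∨a′≈⊤ →
      Apart-cover μ ν positive a a′ b b′ a⟂b a′⟂b′ λ x → ∈ᶜ-∨⁻ a a′ (a∨a′≈⊤ x)
  ; inscribe     = inscribe μ ν positive small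
  ; circumscribe = circumscribe μ ν (inscribe μ ν positive small)
  ; stable       = ≈⊥-stable
  ; positive     = positive
  }

flip-Apart : ∀ μ ν → Separation ν μ (Apart ν μ) → Separation ν μ (flip (Apart μ ν))
flip-Apart μ ν s = record
  { cover        = λ {a} {a′} {b} {b′} a⟂b a′⟂b′ → S.cover {a} {a′} {b} {b′}
      (Apart-sym μ ν {b} {a} a⟂b) (Apart-sym μ ν {b′} {a′} a′⟂b′)
  ; inscribe     = λ a p∈ →
      let b , a⟂b , p∈b = S.inscribe a p∈ in b , Apart-sym ν μ {∁ a} {b} a⟂b , p∈b
  ; circumscribe = λ a q∈ →
      let b , a⟂b , q∈b = S.circumscribe a q∈ in b , Apart-sym ν μ {a} {∁ b} a⟂b , q∈b
  ; stable       = S.stable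
  ; positive     = S.positive
  }
  where module S = Separation s

theorem4p9 : (μ : Measure 𝔄c) → StrictlyPositive μ → NonAtomic μ →
    MetricIsomorphism (𝒥 μ) (μ̂ μ) (𝒥 lebesgue) (μ̂ lebesgue)
theorem4p9 μ positive nonAtomic = Isomorphism.metricIsomorphism
  (clopenSeparation μ lebesgue lebesgue-strictlyPositive lebesgue-smallCylinders)
  (flip-Apart μ lebesgue
    (clopenSeparation lebesgue μ positive (nonAtomic⇒smallCylinders μ nonAtomic)))
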